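{- Let $a,b$ be coprime positive integers. Then the identity $$\frac{1}{[a+b]_q}\genfrac{[}{]}{0pt}{}{a+b}{a,b}_q=\sum_{\mu\in \mathrm{D}(a,b)}q^{|\mu|+h^+_{b,a}(\mu)}$$ holds for this choice of $a,b$ if and only if the identities $$\genfrac{[}{]}{0pt}{}{a+b}{a,b}_q=\sum_{\mu\in \mathrm{R}(a,b)}q^{|\mu|+\mathsf{ml}_{b,a}(\mu)+h^+_{b,a}(\mu)}=\sum_{\mu\in \mathrm{R}(a,b)}q^{|\mu|+\mathsf{ml}_{b,a}(\mu)+h^-_{b,a}(\mu)}$$ hold for this choice of $a,b$.
   Context: $q$ is a formal variable, $[n]_q=1+q+\cdots+q^{n-1}$, $[n]!_q=\prod_{j=1}^n[j]_q$, and $\genfrac{[}{]}{0pt}{}{a+b}{a,b}_q=\frac{[a+b]!_q}{[a]!_q[b]!_q}$. $\mathrm{R}(a,b)$ is the set of sequences of integers $\mu=(\mu_1,\ldots,\mu_a)$ with $b\ge\mu_1\ge\cdots\ge\mu_a\ge0$ (partitions whose diagram fits in the box with corners $(0,0),(b,0),(b,a),(0,a)$). The diagram of $\mu$ is placed in the box left-justified with the first row on top: row $j$ (the $j$-th row from the top) consists of the unit cells with $a-j\le y\le a-j+1$ and $0\le x\le\mu_j$. $|\mu|=\mu_1+\cdots+\mu_a$ is the number of cells. $\mathrm{D}(a,b)$ is the subset of those $\mu\in \mathrm{R}(a,b)$ with $\mu_j\le b(a-j)/a$ for all $j$ (diagram contained in the triangle with vertices $(0,0),(0,a),(b,a)$).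 For a cell $c$ in the diagram of $\mu$, $\mathsf{arm}(c)$ is the number of cells of the diagram in the same row to the right of $c$, and $\mathsf{leg}(c)$ is the number of cells of the diagram in the same column below $c$. $h^+_{b,a}(\mu)$ is the number of cells $c$ of $\mu$ with $-a<a\cdot\mathsf{arm}(c)-b\cdot\mathsf{leg}(c)\le b$, and $h^-_{b,a}(\mu)$ is the number of cells $c$ of $\mu$ with $-a\le a\cdot\mathsf{arm}(c)-b\cdot\mathsf{leg}(c)<b$. The frontier of $\mu\in\mathrm{R}(a,b)$ is the lattice path from $(0,0)$ to $(b,a)$ with unit north and east steps along the boundary of the diagram of $\mu$ (so the diagram consists of the cells of the box above and to the left of the path). The level of a lattice point $(x,y)$ is $by-ax$. $\mathsf{ml}_{b,a}(\mu)$ is the minimum level among the lattice points on the frontier of $\mu$. -}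

module Defs where

open import Data.Bool.Base using (if_then_else_)
open import Data.Fin.Base as Fin using (Fin; toℕ)
import Data.Fin.Properties as Fin
open import Data.Integer.Base as ℤ using (ℤ; +_; 0ℤ; 1ℤ; -_; _-_)
import Data.Integer.Properties as ℤ
import Data.Integer.Tactic.RingSolver as ℤ-Solver
open import Data.List.Base as List
  using (List; []; _∷_; _++_; map; foldr; filter; length; upTo; allFin; concatMap;
         replicate; reverse; applyUpTo; cartesianProductWith)
open import Data.List.NonEmpty.Base as List⁺ using (List⁺; _∷_; _∷⁺_; foldr₁)
open import Data.List.Relation.Unary.All as List using ([]; _∷_)
open import Data.List.Relation.Unary.All.Properties using (all-filter)
open import Data.Nat.Base as ℕ using (ℕ; zero; suc; NonZero)
import Data.Nat.Properties as ℕ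
open import Data.Product.Base using (∃-syntax; _×_; _,_; proj₁; proj₂)
open import Data.Sum.Base using (inj₁; inj₂)
open import Data.Vec.Base as Vec using (Vec; []; _∷_; lookup)
open import Data.Vec.Relation.Unary.All as Vec using ()
open import Data.Vec.Relation.Unary.Linked using (Linked; linked?)
open import Function.Base using (_∘_; case_of_)
open import Relation.Binary.Definitions using (tri<; tri≈; tri>)
open import Relation.Binary.PropositionalEquality
open import Relation.Nullary.Decidable using (yes; no; _×-dec_; does)
open import Relation.Nullary.Negation using (contradiction)
open import Relation.Unary using (Decidable)

open ≡-Reasoning

private variable
  A : Set

-- Laurent polynomials in q over ℤ: finite formal sums of terms c q^e, written (c , e); exponents may repeat,
-- so equality is equality of all coefficients.
Laurent : Set
Laurent = List (ℤ × ℤ)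

termCoeff : ℤ → ℤ → ℤ → ℤ
termCoeff c e n = if does (e ℤ.≟ n) then c else 0ℤ

coeff : Laurent → ℤ → ℤ
coeff []            n = 0ℤ
coeff ((c , e) ∷ p) n = termCoeff c e n ℤ.+ coeff p n

infix 4 _≈_
_≈_ : Laurent → Laurent → Set
p ≈ r = ∀ n → coeff p n ≡ coeff r n

infix 8 q^_
q^_ : ℤ → Laurent
q^ e = (1ℤ , e) ∷ []

infixl 6 _⊕_
_⊕_ : Laurent → Laurent → Laurent
p ⊕ r = p ++ r

infixl 7 _⊗_
_⊗_ : Laurent → Laurent → Laurent
_⊗_ = cartesianProductWith λ (c , e) (d , f) → c ℤ.* d , e ℤ.+ f

∑ : List A → (A → Laurent) → Laurent
∑ xs f = foldr _⊕_ [] (map f xs)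

Nonzero : Laurent → Set
Nonzero p = ∃[ m ] coeff p m ≢ 0ℤ

termCoeff-≡ : ∀ c e → termCoeff c e e ≡ c
termCoeff-≡ c e with e ℤ.≟ e
... | yes _   = refl
... | no  e≢e = contradiction refl e≢e

termCoeff-≢ : ∀ c e n → e ≢ n → termCoeff c e n ≡ 0ℤ
termCoeff-≢ c e n e≢n with e ℤ.≟ n
... | yes e≡n = contradiction e≡n e≢n
... | no  _   = refl

convolve : Laurent → (ℤ → ℤ) → ℤ → ℤ
convolve []            g n = 0ℤ
convolve ((c , e) ∷ p) g n = c ℤ.* g (n - e) ℤ.+ convolve p g n

convolve-cong : ∀ p {g h} → (∀ n → g n ≡ h n) → ∀ n → convolve p g n ≡ convolve p h n
convolve-cong []            g≡h n = refl
convolve-cong ((c , e) ∷ p) g≡h n =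
  cong₂ ℤ._+_ (cong (c ℤ.*_) (g≡h (n - e))) (convolve-cong p g≡h n)

convolve-0 : ∀ p n → convolve p (λ _ → 0ℤ) n ≡ 0ℤ
convolve-0 []            n = refl
convolve-0 ((c , e) ∷ p) n = cong₂ ℤ._+_ (ℤ.*-zeroʳ c) (convolve-0 p n)

convolve-+ : ∀ p g h n →
  convolve p (λ k → g k ℤ.+ h k) n ≡ convolve p g n ℤ.+ convolve p h n
convolve-+ []            g h n = refl
convolve-+ ((c , e) ∷ p) g h n = begin
  c ℤ.* (g (n - e) ℤ.+ h (n - e)) ℤ.+ convolve p (λ k → g k ℤ.+ h k) n
    ≡⟨ cong (λ z → c ℤ.* (g (n - e) ℤ.+ h (n - e)) ℤ.+ z) (convolve-+ p g h n) ⟩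
  c ℤ.* (g (n - e) ℤ.+ h (n - e)) ℤ.+ (convolve p g n ℤ.+ convolve p h n)
    ≡⟨ lemma c (g (n - e)) (h (n - e)) (convolve p g n) (convolve p h n) ⟩
  (c ℤ.* g (n - e) ℤ.+ convolve p g n) ℤ.+ (c ℤ.* h (n - e) ℤ.+ convolve p h n) ∎
  where
  lemma : ∀ c x y u v →
    c ℤ.* (x ℤ.+ y) ℤ.+ (u ℤ.+ v) ≡ (c ℤ.* x ℤ.+ u) ℤ.+ (c ℤ.* y ℤ.+ v)
  lemma = ℤ-Solver.solve-∀

coeff-++ : ∀ p r n → coeff (p ++ r) n ≡ coeff p n ℤ.+ coeff r n
coeff-++ []            r n = sym (ℤ.+-identityˡ _)
coeff-++ ((c , e) ∷ p) r n =
  trans (cong (λ z → termCoeff c e n ℤ.+ z) (coeff-++ p r n))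
        (sym (ℤ.+-assoc (termCoeff c e n) (coeff p n) (coeff r n)))

private
  e+[n-e]≡n : ∀ e n → e ℤ.+ (n - e) ≡ n
  e+[n-e]≡n = ℤ-Solver.solve-∀

  [e+f]-e≡f : ∀ e f → (e ℤ.+ f) - e ≡ f
  [e+f]-e≡f = ℤ-Solver.solve-∀

termCoeff-* : ∀ c e d f n →
  termCoeff (c ℤ.* d) (e ℤ.+ f) n ≡ c ℤ.* termCoeff d f (n - e)
termCoeff-* c e d f n with e ℤ.+ f ℤ.≟ n | f ℤ.≟ n - e
... | yes _    | yes _    = refl
... | yes refl | no f≢    = contradiction (sym ([e+f]-e≡f e f)) f≢
... | no e+f≢  | yes refl = contradiction (e+[n-e]≡n e n) e+f≢
... | no _     | no _     = sym (ℤ.*-zeroʳ c)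

coeff-map-* : ∀ c e r n →
  coeff (map (λ (d , f) → c ℤ.* d , e ℤ.+ f) r) n ≡ c ℤ.* coeff r (n - e)
coeff-map-* c e []            n = sym (ℤ.*-zeroʳ c)
coeff-map-* c e ((d , f) ∷ r) n =
  trans (cong₂ ℤ._+_ (termCoeff-* c e d f n) (coeff-map-* c e r n))
        (sym (ℤ.*-distribˡ-+ c _ _))

coeff-⊗ˡ : ∀ p r n → coeff (p ⊗ r) n ≡ convolve p (coeff r) n
coeff-⊗ˡ []            r n = refl
coeff-⊗ˡ ((c , e) ∷ p) r n =
  trans (coeff-++ (map _ r) (p ⊗ r) n)
        (cong₂ ℤ._+_ (coeff-map-* c e r n) (coeff-⊗ˡ p r n))

coeff-⊗-comm : ∀ p r n → coeff (p ⊗ r) n ≡ convolve r (coeff p) n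
coeff-⊗-comm []            r n = sym (convolve-0 r n)
coeff-⊗-comm ((c , e) ∷ p) r n = begin
  coeff (map _ r ++ p ⊗ r) n
    ≡⟨ coeff-++ (map _ r) (p ⊗ r) n ⟩
  coeff (map _ r) n ℤ.+ coeff (p ⊗ r) n
    ≡⟨ cong₂ ℤ._+_ (single r) (coeff-⊗-comm p r n) ⟩
  convolve r (termCoeff c e) n ℤ.+ convolve r (coeff p) n
    ≡⟨ convolve-+ r (termCoeff c e) (coeff p) n ⟨
  convolve r (coeff ((c , e) ∷ p)) n ∎
  where
  single : ∀ r → coeff (map (λ (d , f) → c ℤ.* d , e ℤ.+ f) r) n
               ≡ convolve r (termCoeff c e) n
  single []            = refl
  single ((d , f) ∷ r) = cong₂ ℤ._+_
    (trans (cong₂ (λ x y → termCoeff x y n) (ℤ.*-comm c d) (ℤ.+-comm e f))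
           (termCoeff-* d f c e n))
    (single r)

⊗-congˡ : ∀ p p′ r → p ≈ p′ → p ⊗ r ≈ p′ ⊗ r
⊗-congˡ p p′ r p≈p′ n = begin
  coeff (p ⊗ r) n         ≡⟨ coeff-⊗-comm p r n ⟩
  convolve r (coeff p) n  ≡⟨ convolve-cong r p≈p′ n ⟩
  convolve r (coeff p′) n ≡⟨ coeff-⊗-comm p′ r n ⟨
  coeff (p′ ⊗ r) n        ∎

VanishesBelow : ℤ → Laurent → Set
VanishesBelow m p = ∀ k → k ℤ.< m → coeff p k ≡ 0ℤ

vanishes-weaken : ∀ p {l m} → l ℤ.≤ m → VanishesBelow m p → VanishesBelow l p
vanishes-weaken p l≤m van k k<l = van k (ℤ.<-≤-trans k<l l≤m)

lowerBound : ∀ p → ∃[ l ] VanishesBelow l p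
lowerBound []            = 0ℤ , λ _ _ → refl
lowerBound ((c , e) ∷ p) with lowerBound p
... | l , van = e ℤ.⊓ l , λ k k< → cong₂ ℤ._+_
  (termCoeff-≢ c e k λ { refl → ℤ.<-irrefl refl (ℤ.<-≤-trans k< (ℤ.i⊓j≤i e l)) })
  (van k (ℤ.<-≤-trans k< (ℤ.i⊓j≤j e l)))

lowest : ∀ p → Nonzero p → ∃[ m ] coeff p m ≢ 0ℤ × VanishesBelow m p
lowest p (m , pₘ≢0) with lowerBound p
... | l , van with ℤ.≤-total m l
...   | inj₁ m≤l = m , pₘ≢0 , vanishes-weaken p m≤l van
...   | inj₂ l≤m = search ℤ.∣ m - l ∣ l m (begin
          l ℤ.+ + ℤ.∣ m - l ∣
            ≡⟨ cong (λ z → l ℤ.+ z) (ℤ.0≤i⇒+∣i∣≡i (ℤ.i≤j⇒0≤j-i l≤m)) ⟩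
          l ℤ.+ (m - l) ≡⟨ e+[n-e]≡n l m ⟩
          m             ∎)
          pₘ≢0 van
  where
  next : ∀ l → coeff p l ≡ 0ℤ → VanishesBelow l p → VanishesBelow (ℤ.suc l) p
  next l pₗ≡0 van k k<1+l with ℤ.<-cmp k l
  ... | tri< k<l _ _  = van k k<l
  ... | tri≈ _ refl _ = pₗ≡0
  ... | tri> _ _ l<k  =
    contradiction (ℤ.<-≤-trans k<1+l (ℤ.i<j⇒suc[i]≤j l<k)) (ℤ.<-irrefl refl)

  search : ∀ d l m → l ℤ.+ + d ≡ m → coeff p m ≢ 0ℤ → VanishesBelow l p →
           ∃[ m ] coeff p m ≢ 0ℤ × VanishesBelow m p
  search zero l m l+d≡m pₘ≢0 van =
    l , subst (λ k → coeff p k ≢ 0ℤ) (trans (sym l+d≡m) (ℤ.+-identityʳ l)) pₘ≢0 , van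
  search (suc d) l m l+d≡m pₘ≢0 van with coeff p l ℤ.≟ 0ℤ
  ... | no  pₗ≢0 = l , pₗ≢0 , van
  ... | yes pₗ≡0 =
    search d (ℤ.suc l) m (trans (shift l (+ d)) l+d≡m) pₘ≢0 (next l pₗ≡0 van)
    where
    shift : ∀ l d → (1ℤ ℤ.+ l) ℤ.+ d ≡ l ℤ.+ (1ℤ ℤ.+ d)
    shift = ℤ-Solver.solve-∀

ExponentsFrom : ℤ → Laurent → Set
ExponentsFrom m = List.All λ (_ , e) → m ℤ.≤ e

from : ℤ → Laurent → Laurent
from m = filter λ (_ , e) → m ℤ.≤? e

coeff-from-≥ : ∀ m p {n} → m ℤ.≤ n → coeff (from m p) n ≡ coeff p n
coeff-from-≥ m []            m≤n = refl
coeff-from-≥ m ((c , e) ∷ p) {n} m≤n with m ℤ.≤? e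
... | yes _   = cong (λ z → termCoeff c e n ℤ.+ z) (coeff-from-≥ m p m≤n)
... | no  m≰e = trans (coeff-from-≥ m p m≤n) (sym (trans
  (cong (ℤ._+ coeff p n) (termCoeff-≢ c e n λ { refl → m≰e m≤n }))
  (ℤ.+-identityˡ _)))

coeff-below : ∀ {m p n} → ExponentsFrom m p → n ℤ.< m → coeff p n ≡ 0ℤ
coeff-below {p = []} []                          n<m = refl
coeff-below {p = (c , e) ∷ _} {n} (m≤e ∷ m≤p) n<m = cong₂ ℤ._+_
  (termCoeff-≢ c e n λ { refl → ℤ.<-irrefl refl (ℤ.<-≤-trans n<m m≤e) })
  (coeff-below m≤p n<m)

from-≈ : ∀ m p → VanishesBelow m p → p ≈ from m p
from-≈ m p van n with m ℤ.≤? n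
... | yes m≤n = sym (coeff-from-≥ m p m≤n)
... | no  m≰n = trans (van n (ℤ.≰⇒> m≰n))
  (sym (coeff-below (all-filter (λ (_ , e) → m ℤ.≤? e) p) (ℤ.≰⇒> m≰n)))

convolve-lowest : ∀ {m p} m′ r → ExponentsFrom m p → VanishesBelow m′ r →
  convolve p (coeff r) (m ℤ.+ m′) ≡ coeff p m ℤ.* coeff r m′
convolve-lowest m′ r [] van = sym (ℤ.*-zeroˡ (coeff r m′))
convolve-lowest {m} {(c , e) ∷ p} m′ r (m≤e ∷ m≤p) van =
  trans (cong₂ ℤ._+_ head (convolve-lowest m′ r m≤p van))
        (sym (ℤ.*-distribʳ-+ (coeff r m′) (termCoeff c e m) (coeff p m)))
  where
  below : m ℤ.< e → m ℤ.+ m′ - e ℤ.< m′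
  below m<e = subst (m ℤ.+ m′ - e ℤ.<_) ([e+f]-e≡f e m′)
                    (ℤ.+-monoˡ-< (- e) (ℤ.+-monoˡ-< m′ m<e))

  head : c ℤ.* coeff r (m ℤ.+ m′ - e) ≡ termCoeff c e m ℤ.* coeff r m′
  head with e ℤ.≟ m
  ... | yes refl = cong (λ k → c ℤ.* coeff r k) ([e+f]-e≡f e m′)
  ... | no  e≢m  = trans
    (cong (c ℤ.*_) (van _ (below (ℤ.≤∧≢⇒< m≤e (e≢m ∘ sym)))))
    (trans (ℤ.*-zeroʳ c) (sym (ℤ.*-zeroˡ (coeff r m′))))

⊗-nonzero : ∀ p r → Nonzero p → Nonzero r → Nonzero (p ⊗ r)
⊗-nonzero p r p≢0 r≢0 with lowest p p≢0 | lowest r r≢0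
... | m , pₘ≢0 , vanₚ | m′ , rₘ≢0 , vanᵣ = m ℤ.+ m′ , λ eq →
  case ℤ.i*j≡0⇒i≡0∨j≡0 (coeff p m) (trans (sym product) eq) of λ where
    (inj₁ pₘ≡0) → pₘ≢0 pₘ≡0
    (inj₂ rₘ≡0) → rₘ≢0 rₘ≡0
  where
  product : coeff (p ⊗ r) (m ℤ.+ m′) ≡ coeff p m ℤ.* coeff r m′
  product = begin
    coeff (p ⊗ r) (m ℤ.+ m′)
      ≡⟨ ⊗-congˡ p (from m p) r (from-≈ m p vanₚ) (m ℤ.+ m′) ⟩
    coeff (from m p ⊗ r) (m ℤ.+ m′)
      ≡⟨ coeff-⊗ˡ (from m p) r (m ℤ.+ m′) ⟩
    convolve (from m p) (coeff r) (m ℤ.+ m′)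
      ≡⟨ convolve-lowest m′ r (all-filter (λ (_ , e) → m ℤ.≤? e) p) vanᵣ ⟩
    coeff (from m p) m ℤ.* coeff r m′
      ≡⟨ cong (ℤ._* coeff r m′) (coeff-from-≥ m p ℤ.≤-refl) ⟩
    coeff p m ℤ.* coeff r m′ ∎

-- The field of fractions of ℤ[q, q⁻¹], which is ℚ(q).
infix 5 _/_⟨_⟩
record Fraction : Set where
  constructor _/_⟨_⟩
  field
    num     : Laurent
    den     : Laurent
    nonzero : Nonzero den

open Fraction public

infix 4 _≃_
_≃_ : Fraction → Fraction → Set
x ≃ y = num x ⊗ den y ≈ num y ⊗ den x

infixl 7 _∙_
_∙_ : Fraction → Fraction → Fraction
x ∙ y = (num x ⊗ num y) / (den x ⊗ den y) ⟨ ⊗-nonzero (den x) (den y) (nonzero x) (nonzero y) ⟩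

1-nonzero : Nonzero (q^ 0ℤ)
1-nonzero = 0ℤ , λ ()

⟦_⟧ : Laurent → Fraction
⟦ p ⟧ = p / q^ 0ℤ ⟨ 1-nonzero ⟩

[_]q : ℕ → Laurent
[ n ]q = ∑ (upTo n) λ i → q^ (+ i)

[_]!q : ℕ → Laurent
[ zero ]!q  = q^ 0ℤ
[ suc n ]!q = [ n ]!q ⊗ [ suc n ]q

[]q-nonzero : ∀ n .{{_ : NonZero n}} → Nonzero [ n ]q
[]q-nonzero (suc n) = 0ℤ , λ eq → 1≢0 (trans (sym (cong (λ z → 1ℤ ℤ.+ z) (tail≡0 suc (λ _ ()) n))) eq)
  where
  1≢0 : 1ℤ ℤ.+ 0ℤ ≢ 0ℤ
  1≢0 ()

  tail≡0 : ∀ (f : ℕ → ℕ) → (∀ i → f i ≢ 0) → ∀ n →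
           coeff (∑ (applyUpTo f n) λ i → q^ (+ i)) 0ℤ ≡ 0ℤ
  tail≡0 f f≢0 zero    = refl
  tail≡0 f f≢0 (suc n) = cong₂ ℤ._+_
    (termCoeff-≢ 1ℤ (+ f 0) 0ℤ (f≢0 0 ∘ ℤ.+-injective)) (tail≡0 (f ∘ suc) (f≢0 ∘ suc) n)

[]!q-nonzero : ∀ n → Nonzero [ n ]!q
[]!q-nonzero zero    = 1-nonzero
[]!q-nonzero (suc n) = ⊗-nonzero [ n ]!q [ suc n ]q ([]!q-nonzero n) ([]q-nonzero (suc n))

1/[_]q : ∀ n .{{_ : NonZero n}} → Fraction
1/[ n ]q = q^ 0ℤ / [ n ]q ⟨ []q-nonzero n ⟩

qBinomial : ℕ → ℕ → Fraction
qBinomial a b = [ a ℕ.+ b ]!q / [ a ]!q ⊗ [ b ]!q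
  ⟨ ⊗-nonzero [ a ]!q [ b ]!q ([]!q-nonzero a) ([]!q-nonzero b) ⟩

-- μ₁, …, μₐ is stored as a vector, so μⱼ is the entry with index j - 1.
InBox : ∀ {a} → ℕ → Vec ℕ a → Set
InBox b μ = Vec.All (ℕ._≤ b) μ × Linked ℕ._≥_ μ

inBox? : ∀ {a} b → Decidable (InBox {a} b)
inBox? b μ = Vec.all? (ℕ._≤? b) μ ×-dec linked? ℕ._≥?_ μ

-- μⱼ ≤ b(a - j)/a for all j, multiplied out by a; the index i stands for j = i + 1 ≤ a.
InTriangle : ∀ {a} → ℕ → Vec ℕ a → Set
InTriangle {a} b μ = ∀ i → a ℕ.* lookup μ i ℕ.≤ b ℕ.* (a ℕ.∸ suc (toℕ i))

inTriangle? : ∀ {a} b → Decidable (InTriangle {a} b)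
inTriangle? {a} b μ = Fin.all? λ i → a ℕ.* lookup μ i ℕ.≤? b ℕ.* (a ℕ.∸ suc (toℕ i))

vectors : List A → ∀ n → List (Vec A n)
vectors xs zero    = [] ∷ []
vectors xs (suc n) = cartesianProductWith _∷_ xs (vectors xs n)

R : (a b : ℕ) → List (Vec ℕ a)
R a b = filter (inBox? b) (vectors (upTo (suc b)) a)

D : (a b : ℕ) → List (Vec ℕ a)
D a b = filter (inTriangle? b) (R a b)

-- (i , x) is the unit cell of the row with index i lying between the
-- abscissae x and x + 1; rows are indexed from the top.
Cell : ℕ → Set
Cell a = Fin a × ℕ

row : ∀ {a} → Cell a → Fin a
row = proj₁

col : ∀ {a} → Cell a → ℕ
col = proj₂

module _ {a : ℕ} (μ : Vec ℕ a) where

  cells : List (Cell a)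
  cells = concatMap (λ i → map (i ,_) (upTo (lookup μ i))) (allFin a)

  size : ℕ
  size = Vec.sum μ

  arm : Cell a → ℕ
  arm c = length (filter (λ c′ → row c′ Fin.≟ row c ×-dec col c ℕ.<? col c′) cells)

  leg : Cell a → ℕ
  leg c = length (filter (λ c′ → col c′ ℕ.≟ col c ×-dec row c Fin.<? row c′) cells)

  module _ (b : ℕ) where

    slope : Cell a → ℤ
    slope c = + a ℤ.* + arm c - + b ℤ.* + leg c

    h⁺ : ℕ
    h⁺ = length (filter (λ c → - (+ a) ℤ.<? slope c ×-dec slope c ℤ.≤? + b) cells)

    h⁻ : ℕ
    h⁻ = length (filter (λ c → - (+ a) ℤ.≤? slope c ×-dec slope c ℤ.<? + b) cells)

data Step : Set where
  north east : Step

-- The path from abscissa x on, given the remaining rows from bottom to top: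
-- for each row, go east to its right end and then one step north; above the
-- top row, go east to abscissa b.
pathFrom : ℕ → ℕ → List ℕ → List Step
pathFrom b x []       = replicate (b ℕ.∸ x) east
pathFrom b x (m ∷ ms) = replicate (m ℕ.∸ x) east ++ north ∷ pathFrom b m ms

frontier : ∀ {a} → ℕ → Vec ℕ a → List Step
frontier b μ = pathFrom b 0 (reverse (Vec.toList μ))

pointsFrom : ℕ × ℕ → List Step → List⁺ (ℕ × ℕ)
pointsFrom p       []          = p ∷ []
pointsFrom (x , y) (north ∷ s) = (x , y) ∷⁺ pointsFrom (x , suc y) s
pointsFrom (x , y) (east ∷ s)  = (x , y) ∷⁺ pointsFrom (suc x , y) s

level : ℕ → ℕ → ℕ × ℕ → ℤ
level a b (x , y) = + b ℤ.* + y - + a ℤ.* + x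

ml : ∀ {a} → ℕ → Vec ℕ a → ℤ
ml {a} b μ = foldr₁ ℤ._⊓_ (List⁺.map (level a b) (pointsFrom (0 , 0) (frontier b μ)))

D-sum : ℕ → ℕ → Laurent
D-sum a b = ∑ (D a b) λ μ → q^ (+ (size μ ℕ.+ h⁺ μ b))

R-sum⁺ : ℕ → ℕ → Laurent
R-sum⁺ a b = ∑ (R a b) λ μ → q^ (+ size μ ℤ.+ ml b μ ℤ.+ + h⁺ μ b)

R-sum⁻ : ℕ → ℕ → Laurent
R-sum⁻ a b = ∑ (R a b) λ μ → q^ (+ size μ ℤ.+ ml b μ ℤ.+ + h⁻ μ b)

instance
  +-nonZero : ∀ {a b} .{{_ : NonZero a}} → NonZero (a ℕ.+ b)
  +-nonZero {suc a} = _

{-# OPTIONS --safe #-}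
module Submission where

-- Read μ as its frontier w, a word in north and east steps, where a north step raises the level by b and an
-- east step lowers it by a. A cell of μ is an east step before a north step, and both h⁺ and h⁻ are conditions
-- on the drop in level between the two; by coprimality the boundary cases never occur, so h⁺ = h⁻. Moving the
-- first step of w to its end changes |μ| + ml + h by exactly the change in r, the number of points of w of
-- negative level: using h⁻ for a north step and h⁺ for an east step, the comparison is a telescoping sum
-- around the closed path of levels. So |μ| + ml + h - r is invariant under rotation. The levels of w being
-- distinct, r takes each value 0, …, a + b - 1 once on the a + b rotations of w, and r = 0 means μ ∈ D(a,b).
-- Averaging over rotations gives (a + b) R-sum = (a + b) [a + b] D-sum coefficient by coefficient, hence
-- R-sum = [a + b] D-sum unconditionally.

open import Defs
open import Data.Fin.Base as Fin using (Fin; zero; suc; toℕ)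
import Data.Fin.Properties as Fin
open import Data.Bool.Base using (if_then_else_)
open import Data.Integer.Base as ℤ using (ℤ; +_; 0ℤ; 1ℤ; -_; _-_)
import Data.Integer.Coprimality as ℤ
open import Data.Integer.Divisibility.Signed
  using (_∣_; divides; ∣⇒∣ᵤ; ∣m∣n⇒∣m+n; ∣m⇒∣m*n; ∣m⇒∣-m; ∣-refl)
import Data.Integer.Properties as ℤ
open import Data.Integer.Tactic.RingSolver using (solve-∀)
open import Data.List.Base
  using (List; []; _∷_; _++_; _∷ʳ_; map; filter; length; upTo; allFin; concatMap;
         cartesianProductWith; replicate; reverse; tabulate)
open import Data.List.Membership.Propositional using (_∈_)
open import Data.List.Membership.Propositional.Properties using (∈-upTo⁻; ∈-filter⁻)
open import Data.List.NonEmpty.Base as List⁺ using (foldr₁)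
import Data.List.Properties as List
open import Data.List.Relation.Binary.Permutation.Propositional as Perm using (_↭_; ↭-sym)
open import Data.List.Relation.Binary.Permutation.Propositional.Properties using (↭-length)
open import Data.List.Relation.Binary.Permutation.Setoid.Properties using (Unique-resp-↭)
open import Data.List.Relation.Unary.All as All using (All; []; _∷_)
import Data.List.Relation.Unary.All.Properties as All
open import Data.List.Relation.Unary.AllPairs as AllPairs using (AllPairs; []; _∷_)
open import Data.List.Relation.Unary.Any using (here; there)
open import Data.List.Relation.Unary.Linked.Properties using (Linked⇒AllPairs)
open import Data.List.Relation.Unary.Unique.Propositional using (Unique)
open import Data.List.Sort ℤ.≤-decTotalOrder using (sort; sort-↭; sort-↗)
open import Data.Nat.Base as ℕ using (ℕ; zero; suc; NonZero; _+_)
open import Data.Nat.Coprimality using (Coprime; coprime-+)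
import Data.Nat.Divisibility as ℕ
import Data.Nat.Properties as ℕ
open import Data.Product.Base using (_×_; _,_; proj₁; proj₂)
open import Data.Vec.Base as Vec using (Vec; []; _∷_; lookup)
open import Data.Vec.Relation.Unary.All as VecAll using ([]; _∷_)
open import Data.Vec.Relation.Unary.Linked as Linked using (Linked; [-]; []; _∷_)
open import Function.Base using (_∘_)
open import Function.Bundles using (_⇔_; mk⇔)
open import Relation.Binary.Definitions using (tri<; tri≈; tri>)
open import Relation.Binary.PropositionalEquality
open import Relation.Nullary.Decidable using (Dec; yes; no; does; _×-dec_)
open import Relation.Nullary.Negation using (¬_; contradiction)
open import Relation.Unary using (Pred; Decidable)

open ≡-Reasoning

private variable
  A B C : Set
  P Q : Set
  a b k m : ℕ

-- Of the three parts of |μ| + ml + h, the first two balance each other under rotation: moving a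
-- north step to the end creates b cells, one for each east step, and lowers the minimum level by b;
-- moving an east step destroys a cells and raises it by a. So only h has to be compared with r. Let
-- d be the drop from the start of an east step to the start of a later north step. The
-- corresponding cell counts for `h⁺` when 0 < d ≤ a + b, and for `h⁻` when 0 ≤ d < a + b. Since r
-- counts levels strictly below 0, the crossing argument fits the half-open interval of `h⁻` when a
-- north step moves and that of `h⁺` when an east step moves. Using both for one invariant is why
-- the two have to be identified. Both uses of coprimality, `h⁺` = `h⁻` and distinct levels, rest on
-- one fact: a nonempty stretch of fewer than a + b steps never changes the level by a multiple of a
-- + b. Orbits are not formed. Rotation permutes the words, so adding up a + b successive rotations
-- multiplies a sum by a + b, and this integer factor is cancelled in each coefficient.

𝟙 : Dec P → ℤ
𝟙 d = if does d then 1ℤ else 0ℤ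

𝟙-yes : (d : Dec P) → P → 𝟙 d ≡ 1ℤ
𝟙-yes (yes _) p = refl
𝟙-yes (no ¬p) p = contradiction p ¬p

𝟙-no : (d : Dec P) → ¬ P → 𝟙 d ≡ 0ℤ
𝟙-no (yes p) ¬p = contradiction p ¬p
𝟙-no (no _)  ¬p = refl

𝟙-cong : (c : Dec P) (d : Dec Q) → (P → Q) → (Q → P) → 𝟙 c ≡ 𝟙 d
𝟙-cong (yes p) d f g = sym (𝟙-yes d (f p))
𝟙-cong (no ¬p) d f g = sym (𝟙-no d (¬p ∘ g))

𝟙-×-dec : (c : Dec P) (d : Dec Q) → 𝟙 (c ×-dec d) ≡ 𝟙 c ℤ.* 𝟙 d
𝟙-×-dec (yes _) (yes _) = refl
𝟙-×-dec (yes _) (no _)  = refl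
𝟙-×-dec (no _)  _       = refl

𝟙-*-cong : (d : Dec P) {x y : ℤ} → (P → x ≡ y) → 𝟙 d ℤ.* x ≡ 𝟙 d ℤ.* y
𝟙-*-cong (yes p) eq = cong (1ℤ ℤ.*_) (eq p)
𝟙-*-cong (no _)  eq = refl

𝟙-<-flip : ∀ {x y} → x ≢ y → 𝟙 (x ℤ.<? y) ≡ 1ℤ - 𝟙 (y ℤ.<? x)
𝟙-<-flip {x} {y} x≢y with ℤ.<-cmp x y
... | tri< x<y _ y≮x = trans (𝟙-yes (x ℤ.<? y) x<y) (cong (λ z → 1ℤ - z) (sym (𝟙-no (y ℤ.<? x) y≮x)))
... | tri≈ _ x≡y _   = contradiction x≡y x≢y
... | tri> x≮y _ y<x = trans (𝟙-no (x ℤ.<? y) x≮y) (cong (λ z → 1ℤ - z) (sym (𝟙-yes (y ℤ.<? x) y<x)))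

𝟙-<-+ : ∀ x y k → 𝟙 (x ℤ.+ k ℤ.<? y ℤ.+ k) ≡ 𝟙 (x ℤ.<? y)
𝟙-<-+ x y k = 𝟙-cong (x ℤ.+ k ℤ.<? y ℤ.+ k) (x ℤ.<? y)
  (λ lt → subst₂ ℤ._<_ (cancel x k) (cancel y k) (ℤ.+-monoˡ-< (- k) lt)) (ℤ.+-monoˡ-< k)
  where
  cancel : ∀ x k → x ℤ.+ k ℤ.+ - k ≡ x
  cancel = solve-∀

-- Phrased through differences, so that each use costs one ring identity and no common summand has
-- to be exhibited.
𝟙-<-shift : ∀ x y x′ y′ → x′ - x ≡ y′ - y → 𝟙 (x ℤ.<? y) ≡ 𝟙 (x′ ℤ.<? y′)
𝟙-<-shift x y x′ y′ eq = trans (sym (𝟙-<-+ x y (x′ - x)))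
  (cong₂ (λ u v → 𝟙 (u ℤ.<? v)) (lemma x x′) (trans (cong (λ z → y ℤ.+ z) eq) (lemma y y′)))
  where
  lemma : ∀ x y → x ℤ.+ (y - x) ≡ y
  lemma = solve-∀

𝟙-neg-< : ∀ x y → 𝟙 (- x ℤ.<? - y) ≡ 𝟙 (y ℤ.<? x)
𝟙-neg-< x y = 𝟙-cong (- x ℤ.<? - y) (y ℤ.<? x) ℤ.neg-cancel-< ℤ.neg-mono-<

-- Since x ≤ y, the second event on the right is contained in the first. Differences of thresholds
-- are the form that the telescoping sums can absorb.
𝟙-interval-<≤ : ∀ {x y} s → x ℤ.≤ y → 𝟙 (x ℤ.<? s ×-dec s ℤ.≤? y) ≡ 𝟙 (x ℤ.<? s) - 𝟙 (y ℤ.<? s)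
𝟙-interval-<≤ {x} {y} s x≤y = go (y ℤ.<? s)
  where
  go : Dec (y ℤ.< s) → 𝟙 (x ℤ.<? s ×-dec s ℤ.≤? y) ≡ 𝟙 (x ℤ.<? s) - 𝟙 (y ℤ.<? s)
  go (yes y<s) = trans (𝟙-no (x ℤ.<? s ×-dec s ℤ.≤? y) λ (_ , s≤y) → ℤ.<⇒≱ y<s s≤y)
    (sym (cong₂ _-_ (𝟙-yes (x ℤ.<? s) (ℤ.≤-<-trans x≤y y<s)) (𝟙-yes (y ℤ.<? s) y<s)))
  go (no y≮s) = trans (𝟙-cong (x ℤ.<? s ×-dec s ℤ.≤? y) (x ℤ.<? s) proj₁ (_, ℤ.≮⇒≥ y≮s))
    (sym (trans (cong (λ z → 𝟙 (x ℤ.<? s) - z) (𝟙-no (y ℤ.<? s) y≮s)) (ℤ.+-identityʳ _)))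

𝟙-interval-≤< : ∀ {x y} s → x ℤ.≤ y → 𝟙 (x ℤ.≤? s ×-dec s ℤ.<? y) ≡ 𝟙 (s ℤ.<? y) - 𝟙 (s ℤ.<? x)
𝟙-interval-≤< {x} {y} s x≤y = go (s ℤ.<? x)
  where
  go : Dec (s ℤ.< x) → 𝟙 (x ℤ.≤? s ×-dec s ℤ.<? y) ≡ 𝟙 (s ℤ.<? y) - 𝟙 (s ℤ.<? x)
  go (yes s<x) = trans (𝟙-no (x ℤ.≤? s ×-dec s ℤ.<? y) λ (x≤s , _) → ℤ.<⇒≱ s<x x≤s)
    (sym (cong₂ _-_ (𝟙-yes (s ℤ.<? y) (ℤ.<-≤-trans s<x x≤y)) (𝟙-yes (s ℤ.<? x) s<x)))
  go (no s≮x) = trans (𝟙-cong (x ℤ.≤? s ×-dec s ℤ.<? y) (s ℤ.<? y) proj₂ (ℤ.≮⇒≥ s≮x ,_))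
    (sym (trans (cong (λ z → 𝟙 (s ℤ.<? y) - z) (𝟙-no (s ℤ.<? x) s≮x)) (ℤ.+-identityʳ _)))

-- Finite sums

sum : List A → (A → ℤ) → ℤ
sum []       f = 0ℤ
sum (x ∷ xs) f = f x ℤ.+ sum xs f

sum-cong-∈ : ∀ (xs : List A) {f g : A → ℤ} → (∀ {x} → x ∈ xs → f x ≡ g x) → sum xs f ≡ sum xs g
sum-cong-∈ []       eq = refl
sum-cong-∈ (x ∷ xs) eq = cong₂ ℤ._+_ (eq (here refl)) (sum-cong-∈ xs (eq ∘ there))

sum-cong : ∀ (xs : List A) {f g : A → ℤ} → (∀ x → f x ≡ g x) → sum xs f ≡ sum xs g
sum-cong xs eq = sum-cong-∈ xs λ {x} _ → eq x

sum-0 : (xs : List A) → sum xs (λ _ → 0ℤ) ≡ 0ℤ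
sum-0 []       = refl
sum-0 (x ∷ xs) = trans (ℤ.+-identityˡ _) (sum-0 xs)

interchange : ∀ a b c d → (a ℤ.+ b) ℤ.+ (c ℤ.+ d) ≡ (a ℤ.+ c) ℤ.+ (b ℤ.+ d)
interchange = solve-∀

sum-+ : ∀ (xs : List A) f g → sum xs (λ x → f x ℤ.+ g x) ≡ sum xs f ℤ.+ sum xs g
sum-+ []       f g = refl
sum-+ (x ∷ xs) f g = trans (cong (λ z → f x ℤ.+ g x ℤ.+ z) (sum-+ xs f g)) (interchange (f x) (g x) _ _)

sum-* : ∀ (xs : List A) c f → sum xs (λ x → c ℤ.* f x) ≡ c ℤ.* sum xs f
sum-* []       c f = sym (ℤ.*-zeroʳ c)
sum-* (x ∷ xs) c f = trans (cong (λ z → c ℤ.* f x ℤ.+ z) (sum-* xs c f)) (sym (ℤ.*-distribˡ-+ c _ _))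

sum-++ : ∀ (xs ys : List A) f → sum (xs ++ ys) f ≡ sum xs f ℤ.+ sum ys f
sum-++ []       ys f = sym (ℤ.+-identityˡ _)
sum-++ (x ∷ xs) ys f = trans (cong (λ z → f x ℤ.+ z) (sum-++ xs ys f)) (sym (ℤ.+-assoc (f x) _ _))

sum-map : ∀ (h : A → B) xs f → sum (map h xs) f ≡ sum xs (f ∘ h)
sum-map h []       f = refl
sum-map h (x ∷ xs) f = cong (λ z → f (h x) ℤ.+ z) (sum-map h xs f)

sum-concatMap : ∀ (h : A → List B) xs f → sum (concatMap h xs) f ≡ sum xs λ x → sum (h x) f
sum-concatMap h []       f = refl
sum-concatMap h (x ∷ xs) f =
  trans (sum-++ (h x) _ f) (cong (λ z → sum (h x) f ℤ.+ z) (sum-concatMap h xs f))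

sum-cartesianProductWith : ∀ (h : A → B → C) xs ys f →
  sum (cartesianProductWith h xs ys) f ≡ sum xs λ x → sum ys λ y → f (h x y)
sum-cartesianProductWith h []       ys f = refl
sum-cartesianProductWith h (x ∷ xs) ys f = trans (sum-++ (map (h x) ys) _ f)
  (cong₂ ℤ._+_ (sum-map (h x) ys f) (sum-cartesianProductWith h xs ys f))

sum-filter : ∀ {P : Pred A _} (P? : Decidable P) xs f →
  sum (filter P? xs) f ≡ sum xs λ x → 𝟙 (P? x) ℤ.* f x
sum-filter P? []       f = refl
sum-filter P? (x ∷ xs) f with P? x
... | yes _ = cong₂ ℤ._+_ (sym (ℤ.*-identityˡ (f x))) (sum-filter P? xs f)
... | no _  = trans (sum-filter P? xs f) (sym (ℤ.+-identityˡ _))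

length-filter : ∀ {P : Pred A _} (P? : Decidable P) xs →
  + length (filter P? xs) ≡ sum xs (𝟙 ∘ P?)
length-filter P? []       = refl
length-filter P? (x ∷ xs) with P? x
... | yes _ = cong (λ z → 1ℤ ℤ.+ z) (length-filter P? xs)
... | no _  = trans (length-filter P? xs) (sym (ℤ.+-identityˡ _))

sum-swap : ∀ (xs : List A) (ys : List B) (f : A → B → ℤ) →
  sum xs (λ x → sum ys (f x)) ≡ sum ys (λ y → sum xs λ x → f x y)
sum-swap []       ys f = sym (sum-0 ys)
sum-swap (x ∷ xs) ys f = trans (cong (λ z → sum ys (f x) ℤ.+ z) (sum-swap xs ys f))
  (sym (sum-+ ys (f x) λ y → sum xs λ x → f x y))

sum-↭ : ∀ {xs ys : List A} f → xs ↭ ys → sum xs f ≡ sum ys f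
sum-↭ f Perm.refl = refl
sum-↭ f (Perm.prep x p) = cong (λ z → f x ℤ.+ z) (sum-↭ f p)
sum-↭ f (Perm.swap x y p) = trans (cong (λ z → f x ℤ.+ (f y ℤ.+ z)) (sum-↭ f p)) (lemma (f x) (f y) _)
  where
  lemma : ∀ u v w → u ℤ.+ (v ℤ.+ w) ≡ v ℤ.+ (u ℤ.+ w)
  lemma = solve-∀
sum-↭ f (Perm.trans p q) = trans (sum-↭ f p) (sum-↭ f q)

sum-upTo-last : ∀ n (f : ℕ → ℤ) → sum (upTo (suc n)) f ≡ sum (upTo n) f ℤ.+ f n
sum-upTo-last n f = begin
  sum (upTo (suc n)) f                ≡⟨ cong (λ xs → sum xs f) (List.upTo-∷ʳ n) ⟨
  sum (upTo n ∷ʳ n) f                 ≡⟨ sum-++ (upTo n) _ f ⟩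
  sum (upTo n) f ℤ.+ (f n ℤ.+ 0ℤ)     ≡⟨ cong (λ z → sum (upTo n) f ℤ.+ z) (ℤ.+-identityʳ (f n)) ⟩
  sum (upTo n) f ℤ.+ f n              ∎

sum-upTo-first : ∀ n (f : ℕ → ℤ) → sum (upTo (suc n)) f ≡ f 0 ℤ.+ sum (upTo n) (f ∘ suc)
sum-upTo-first n f = cong (λ z → f 0 ℤ.+ z)
  (trans (cong (λ xs → sum xs f) (sym (List.map-upTo suc n))) (sum-map suc (upTo n) f))

sum-upTo-1 : ∀ n → sum (upTo n) (λ _ → 1ℤ) ≡ + n
sum-upTo-1 zero    = refl
sum-upTo-1 (suc n) = trans (sum-upTo-first n λ _ → 1ℤ) (cong (λ z → 1ℤ ℤ.+ z) (sum-upTo-1 n))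

sum-upTo-𝟙≟ : ∀ {n} k (f : ℕ → ℤ) → k ℕ.< n → sum (upTo n) (λ i → 𝟙 (i ℕ.≟ k) ℤ.* f i) ≡ f k
sum-upTo-𝟙≟ {suc n} zero f _ = begin
  sum (upTo (suc n)) (λ i → 𝟙 (i ℕ.≟ 0) ℤ.* f i)
    ≡⟨ sum-upTo-first n (λ i → 𝟙 (i ℕ.≟ 0) ℤ.* f i) ⟩
  1ℤ ℤ.* f 0 ℤ.+ sum (upTo n) (λ i → 0ℤ)
    ≡⟨ cong₂ ℤ._+_ (ℤ.*-identityˡ (f 0)) (sum-0 (upTo n)) ⟩
  f 0 ℤ.+ 0ℤ
    ≡⟨ ℤ.+-identityʳ (f 0) ⟩
  f 0 ∎
sum-upTo-𝟙≟ {suc n} (suc k) f (ℕ.s≤s k<n) = begin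
  sum (upTo (suc n)) (λ i → 𝟙 (i ℕ.≟ suc k) ℤ.* f i)
    ≡⟨ sum-upTo-first n (λ i → 𝟙 (i ℕ.≟ suc k) ℤ.* f i) ⟩
  0ℤ ℤ.+ sum (upTo n) (λ i → 𝟙 (suc i ℕ.≟ suc k) ℤ.* f (suc i))
    ≡⟨ ℤ.+-identityˡ _ ⟩
  sum (upTo n) (λ i → 𝟙 (suc i ℕ.≟ suc k) ℤ.* f (suc i))
    ≡⟨ sum-cong (upTo n) (λ i → cong (ℤ._* f (suc i))
         (𝟙-cong (suc i ℕ.≟ suc k) (i ℕ.≟ k) ℕ.suc-injective (cong suc))) ⟩
  sum (upTo n) (λ i → 𝟙 (i ℕ.≟ k) ℤ.* f (suc i))
    ≡⟨ sum-upTo-𝟙≟ k (f ∘ suc) k<n ⟩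
  f (suc k) ∎

-- Ranks in a list of distinct integers

rank : List ℤ → ℤ → ℤ
rank xs x = sum xs λ y → 𝟙 (y ℤ.<? x)

rank-minimal : ∀ {x} xs → All (x ℤ.≤_) xs → rank xs x ≡ 0ℤ
rank-minimal []       []        = refl
rank-minimal (y ∷ xs) (x≤y ∷ x≤xs) =
  cong₂ ℤ._+_ (𝟙-no (y ℤ.<? _) (ℤ.≤⇒≯ x≤y)) (rank-minimal xs x≤xs)

-- The head has rank 0 and adds one to the rank of every later entry. The induction therefore
-- replaces `φ` by its composite with the successor, which is why `φ` is arbitrary.
sum-rank-ascending : ∀ xs → AllPairs ℤ._<_ xs → ∀ (φ : ℤ → ℤ) →
  sum xs (φ ∘ rank xs) ≡ sum (upTo (length xs)) (φ ∘ +_)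
sum-rank-ascending []       []          φ = refl
sum-rank-ascending (x ∷ xs) (x<xs ∷ xs↗) φ = begin
  φ (rank (x ∷ xs) x) ℤ.+ sum xs (φ ∘ rank (x ∷ xs))
    ≡⟨ cong₂ (λ u v → φ u ℤ.+ v)
         (rank-minimal (x ∷ xs) (ℤ.≤-refl ∷ All.map ℤ.<⇒≤ x<xs))
         (sum-cong-∈ xs λ {y} y∈xs → cong (λ z → φ (z ℤ.+ rank xs y)) (𝟙-yes (x ℤ.<? y) (All.lookup x<xs y∈xs))) ⟩
  φ 0ℤ ℤ.+ sum xs (φ ∘ (λ z → 1ℤ ℤ.+ z) ∘ rank xs)
    ≡⟨ cong (λ z → φ 0ℤ ℤ.+ z) (sum-rank-ascending xs xs↗ (φ ∘ (λ z → 1ℤ ℤ.+ z))) ⟩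
  φ 0ℤ ℤ.+ sum (upTo (length xs)) (φ ∘ +_ ∘ suc)
    ≡⟨ sum-upTo-first (length xs) (φ ∘ +_) ⟨
  sum (upTo (suc (length xs))) (φ ∘ +_) ∎

-- Sum and ranks are both invariant under permutation, so the list may be sorted, and distinctness
-- makes the sorted list strictly ascending. With `φ` arbitrary, this expresses that the ranks are
-- 0, 1, 2, ... once each.
sum-rank : ∀ xs → Unique xs → ∀ (φ : ℤ → ℤ) →
  sum xs (φ ∘ rank xs) ≡ sum (upTo (length xs)) (φ ∘ +_)
sum-rank xs xs! φ = begin
  sum xs (φ ∘ rank xs) ≡⟨ sum-cong xs (λ x → cong φ (sum-↭ _ xs↭)) ⟩
  sum xs (φ ∘ rank sorted) ≡⟨ sum-↭ _ xs↭ ⟩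
  sum sorted (φ ∘ rank sorted) ≡⟨ sum-rank-ascending sorted sorted< φ ⟩
  sum (upTo (length sorted)) (φ ∘ +_) ≡⟨ cong (λ n → sum (upTo n) (φ ∘ +_)) (↭-length (sort-↭ xs)) ⟩
  sum (upTo (length xs)) (φ ∘ +_) ∎
  where
  sorted = sort xs

  xs↭ : xs ↭ sorted
  xs↭ = ↭-sym (sort-↭ xs)

  sorted< : AllPairs ℤ._<_ sorted
  sorted< = AllPairs.zipWith (λ (x≤y , x≢y) → ℤ.≤∧≢⇒< x≤y x≢y)
    ( Linked⇒AllPairs ℤ.≤-trans (sort-↗ xs)
    , Unique-resp-↭ (setoid ℤ) (Perm.↭⇒↭ₛ xs↭) xs! )

-- Words and partitions

Word : Set
Word = List Step

#N #E : Word → ℕ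
#N []          = 0
#N (north ∷ w) = suc (#N w)
#N (east ∷ w)  = #N w
#E []          = 0
#E (north ∷ w) = #E w
#E (east ∷ w)  = suc (#E w)

length-#N+#E : ∀ w → #N w + #E w ≡ length w
length-#N+#E []          = refl
length-#N+#E (north ∷ w) = cong suc (length-#N+#E w)
length-#N+#E (east ∷ w)  = trans (ℕ.+-suc (#N w) (#E w)) (cong suc (length-#N+#E w))

#N-∷ʳ-north : ∀ w → #N (w ∷ʳ north) ≡ suc (#N w)
#N-∷ʳ-north []          = refl
#N-∷ʳ-north (north ∷ w) = cong suc (#N-∷ʳ-north w)
#N-∷ʳ-north (east ∷ w)  = #N-∷ʳ-north w

#N-∷ʳ-east : ∀ w → #N (w ∷ʳ east) ≡ #N w
#N-∷ʳ-east []          = refl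
#N-∷ʳ-east (north ∷ w) = cong suc (#N-∷ʳ-east w)
#N-∷ʳ-east (east ∷ w)  = #N-∷ʳ-east w

words : ℕ → List Word
words zero    = [] ∷ []
words (suc n) = map (north ∷_) (words n) ++ map (east ∷_) (words n)

words-length : ∀ n → All (λ w → length w ≡ n) (words n)
words-length zero    = refl ∷ []
words-length (suc n) = All.++⁺ (All.map⁺ (All.map (cong suc) (words-length n)))
                               (All.map⁺ (All.map (cong suc) (words-length n)))

sum-words : ∀ n (f : Word → ℤ) →
  sum (words (suc n)) f ≡ sum (words n) (f ∘ (north ∷_)) ℤ.+ sum (words n) (f ∘ (east ∷_))
sum-words n f = trans (sum-++ (map (north ∷_) (words n)) _ f)
  (cong₂ ℤ._+_ (sum-map (north ∷_) (words n) f) (sum-map (east ∷_) (words n) f))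

-- `words` branches on the first step, whereas rotations and frontiers act at the end of a word. A
-- sum ignores order, so the choice of the last step can be pulled past that of the first.
sum-words-∷ʳ : ∀ n (f : Word → ℤ) →
  sum (words (suc n)) f ≡ sum (words n) (f ∘ (_∷ʳ north)) ℤ.+ sum (words n) (f ∘ (_∷ʳ east))
sum-words-∷ʳ zero    f = sum-words zero f
sum-words-∷ʳ (suc n) f = begin
  sum (words (suc (suc n))) f
    ≡⟨ sum-words (suc n) f ⟩
  sum (words (suc n)) (f ∘ (north ∷_)) ℤ.+ sum (words (suc n)) (f ∘ (east ∷_))
    ≡⟨ cong₂ ℤ._+_ (sum-words-∷ʳ n (f ∘ (north ∷_))) (sum-words-∷ʳ n (f ∘ (east ∷_))) ⟩
  (Σ λ w → f (north ∷ w ∷ʳ north)) ℤ.+ (Σ λ w → f (north ∷ w ∷ʳ east)) ℤ.+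
  ((Σ λ w → f (east ∷ w ∷ʳ north)) ℤ.+ (Σ λ w → f (east ∷ w ∷ʳ east)))
    ≡⟨ interchange (Σ λ w → f (north ∷ w ∷ʳ north)) _ _ _ ⟩
  (Σ λ w → f (north ∷ w ∷ʳ north)) ℤ.+ (Σ λ w → f (east ∷ w ∷ʳ north)) ℤ.+
  ((Σ λ w → f (north ∷ w ∷ʳ east)) ℤ.+ (Σ λ w → f (east ∷ w ∷ʳ east)))
    ≡⟨ cong₂ ℤ._+_ (sum-words n (f ∘ (_∷ʳ north))) (sum-words n (f ∘ (_∷ʳ east))) ⟨
  sum (words (suc n)) (f ∘ (_∷ʳ north)) ℤ.+ sum (words (suc n)) (f ∘ (_∷ʳ east)) ∎
  where
  Σ = sum (words n)

-- Rotation of words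

rot : Word → Word
rot []      = []
rot (s ∷ w) = w ∷ʳ s

#N-rot : ∀ w → #N (rot w) ≡ #N w
#N-rot []          = refl
#N-rot (north ∷ w) = #N-∷ʳ-north w
#N-rot (east ∷ w)  = #N-∷ʳ-east w

-- Splitting off the first step on the left and the last step on the right yields literally the same
-- two sums.
sum-words-rot : ∀ n (f : Word → ℤ) → sum (words n) (f ∘ rot) ≡ sum (words n) f
sum-words-rot zero    f = refl
sum-words-rot (suc n) f = trans (sum-words n (f ∘ rot)) (sym (sum-words-∷ʳ n f))

balanced : ℕ → ℕ → List Word
balanced a b = filter (λ w → #N w ℕ.≟ a) (words (a + b))

balanced-counts : ∀ {w} → w ∈ balanced a b → #N w ≡ a × #E w ≡ b
balanced-counts {a} {b} {w} w∈ with ∈-filter⁻ (λ w → #N w ℕ.≟ a) {xs = words (a + b)} w∈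
... | w∈words , refl = refl ,
  ℕ.+-cancelˡ-≡ (#N w) (#E w) b
    (trans (length-#N+#E w) (All.lookup (words-length (#N w + b)) w∈words))

-- The words of length n with a norths; unlike balanced, this shape is closed under removing the last step.
sumN : ℕ → ℕ → (Word → ℤ) → ℤ
sumN n a f = sum (words n) λ w → 𝟙 (#N w ℕ.≟ a) ℤ.* f w

sumN≡sum-balanced : ∀ a b (f : Word → ℤ) → sum (balanced a b) f ≡ sumN (a + b) a f
sumN≡sum-balanced a b f = sum-filter (λ w → #N w ℕ.≟ a) (words (a + b)) f

sum-balanced-rot : ∀ a b (f : Word → ℤ) → sum (balanced a b) (f ∘ rot) ≡ sum (balanced a b) f
sum-balanced-rot a b f = begin
  sum (balanced a b) (f ∘ rot)
    ≡⟨ sumN≡sum-balanced a b (f ∘ rot) ⟩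
  sum (words (a + b)) (λ w → 𝟙 (#N w ℕ.≟ a) ℤ.* f (rot w))
    ≡⟨ sum-cong (words (a + b)) (λ w → cong (λ i → 𝟙 (i ℕ.≟ a) ℤ.* f (rot w)) (sym (#N-rot w))) ⟩
  sum (words (a + b)) (λ w → 𝟙 (#N (rot w) ℕ.≟ a) ℤ.* f (rot w))
    ≡⟨ sum-words-rot (a + b) (λ w → 𝟙 (#N w ℕ.≟ a) ℤ.* f w) ⟩
  sumN (a + b) a f
    ≡⟨ sumN≡sum-balanced a b f ⟨
  sum (balanced a b) f ∎

sumN-∷ʳ : ∀ n a (f : Word → ℤ) →
  sumN (suc n) (suc a) f ≡ sumN n a (f ∘ (_∷ʳ north)) ℤ.+ sumN n (suc a) (f ∘ (_∷ʳ east))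
sumN-∷ʳ n a f = trans (sum-words-∷ʳ n λ w → 𝟙 (#N w ℕ.≟ suc a) ℤ.* f w) (cong₂ ℤ._+_
  (sum-cong (words n) λ w → cong (ℤ._* f (w ∷ʳ north))
    (𝟙-cong (#N (w ∷ʳ north) ℕ.≟ suc a) (#N w ℕ.≟ a)
      (ℕ.suc-injective ∘ trans (sym (#N-∷ʳ-north w))) (trans (#N-∷ʳ-north w) ∘ cong suc)))
  (sum-cong (words n) λ w → cong (λ i → 𝟙 (i ℕ.≟ suc a) ℤ.* f (w ∷ʳ east)) (#N-∷ʳ-east w)))

sumN-∷ʳ-0 : ∀ n (f : Word → ℤ) → sumN (suc n) 0 f ≡ sumN n 0 (f ∘ (_∷ʳ east))
sumN-∷ʳ-0 n f = begin
  sumN (suc n) 0 f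
    ≡⟨ sum-words-∷ʳ n (λ w → 𝟙 (#N w ℕ.≟ 0) ℤ.* f w) ⟩
  sum (words n) (λ w → 𝟙 (#N (w ∷ʳ north) ℕ.≟ 0) ℤ.* f (w ∷ʳ north)) ℤ.+
  sum (words n) (λ w → 𝟙 (#N (w ∷ʳ east) ℕ.≟ 0) ℤ.* f (w ∷ʳ east))
    ≡⟨ cong₂ ℤ._+_
         (trans (sum-cong (words n) λ w → cong (λ i → 𝟙 (i ℕ.≟ 0) ℤ.* f (w ∷ʳ north)) (#N-∷ʳ-north w))
                (sum-0 (words n)))
         (sum-cong (words n) λ w → cong (λ i → 𝟙 (i ℕ.≟ 0) ℤ.* f (w ∷ʳ east)) (#N-∷ʳ-east w)) ⟩
  0ℤ ℤ.+ sumN n 0 (f ∘ (_∷ʳ east))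
    ≡⟨ ℤ.+-identityˡ _ ⟩
  sumN n 0 (f ∘ (_∷ʳ east)) ∎

sumN-> : ∀ {n a} → n ℕ.< a → ∀ f → sumN n a f ≡ 0ℤ
sumN-> {n} {a} n<a f = trans (sum-cong-∈ (words n) vanishes) (sum-0 (words n))
  where
  vanishes : ∀ {w} → w ∈ words n → 𝟙 (#N w ℕ.≟ a) ℤ.* f w ≡ 0ℤ
  vanishes {w} w∈ = cong (ℤ._* f w) (𝟙-no (#N w ℕ.≟ a) λ { refl → ℕ.<⇒≱ n<a
    (subst (#N w ℕ.≤_) (trans (length-#N+#E w) (All.lookup (words-length n) w∈)) (ℕ.m≤m+n (#N w) (#E w))) })

replicate-∷ʳ : ∀ n (s : Step) → replicate n s ∷ʳ s ≡ replicate (suc n) s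
replicate-∷ʳ zero    s = refl
replicate-∷ʳ (suc n) s = cong (s ∷_) (replicate-∷ʳ n s)

sumN-0 : ∀ n (f : Word → ℤ) → sumN n 0 f ≡ f (replicate n east)
sumN-0 zero    f = trans (ℤ.+-identityʳ _) (ℤ.*-identityˡ (f []))
sumN-0 (suc n) f = begin
  sumN (suc n) 0 f               ≡⟨ sumN-∷ʳ-0 n f ⟩
  sumN n 0 (f ∘ (_∷ʳ east))      ≡⟨ sumN-0 n (f ∘ (_∷ʳ east)) ⟩
  f (replicate n east ∷ʳ east)   ≡⟨ cong f (replicate-∷ʳ n east) ⟩
  f (replicate (suc n) east)     ∎

-- Partitions in a box and their frontiers

pathFrom-∷ʳ : ∀ b x ms m →
  pathFrom b x (ms ∷ʳ m) ≡ pathFrom m x ms ++ north ∷ replicate (b ℕ.∸ m) east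
pathFrom-∷ʳ b x []       m = refl
pathFrom-∷ʳ b x (l ∷ ms) m = trans
  (cong (λ w → replicate (l ℕ.∸ x) east ++ north ∷ w) (pathFrom-∷ʳ b l ms m))
  (sym (List.++-assoc (replicate (l ℕ.∸ x) east) (north ∷ pathFrom m l ms) _))

-- The head of the vector is the top row, which the path reaches last. Recursion on the vector thus
-- becomes recursion on the end of the frontier.
frontier-∷ : ∀ b m (μ : Vec ℕ k) →
  frontier b (m ∷ μ) ≡ frontier m μ ++ north ∷ replicate (b ℕ.∸ m) east
frontier-∷ b m μ = trans (cong (pathFrom b 0) (List.unfold-reverse m (Vec.toList μ)))
  (pathFrom-∷ʳ b 0 (reverse (Vec.toList μ)) m)

frontier-north : ∀ b (μ : Vec ℕ k) → frontier b (b ∷ μ) ≡ frontier b μ ∷ʳ north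
frontier-north b μ = trans (frontier-∷ b b μ)
  (cong (λ i → frontier b μ ++ north ∷ replicate i east) (ℕ.n∸n≡0 b))

-- The bound guards against truncated subtraction: `suc b ∸ m` exceeds `b ∸ m` by one only when m ≤
-- b.
frontier-east : ∀ {b} {μ : Vec ℕ k} → VecAll.All (ℕ._≤ b) μ → frontier (suc b) μ ≡ frontier b μ ∷ʳ east
frontier-east {b = b} []                         = sym (replicate-∷ʳ b east)
frontier-east {b = b} {μ = m ∷ μ} (m≤b ∷ _) = begin
  frontier (suc b) (m ∷ μ)
    ≡⟨ frontier-∷ (suc b) m μ ⟩
  frontier m μ ++ north ∷ replicate (suc b ℕ.∸ m) east
    ≡⟨ cong (λ i → frontier m μ ++ north ∷ replicate i east) (ℕ.+-∸-assoc 1 m≤b) ⟩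
  frontier m μ ++ north ∷ replicate (suc (b ℕ.∸ m)) east
    ≡⟨ cong (λ w → frontier m μ ++ north ∷ w) (replicate-∷ʳ (b ℕ.∸ m) east) ⟨
  frontier m μ ++ (north ∷ replicate (b ℕ.∸ m) east) ∷ʳ east
    ≡⟨ List.++-assoc (frontier m μ) _ _ ⟨
  (frontier m μ ++ north ∷ replicate (b ℕ.∸ m) east) ∷ʳ east
    ≡⟨ cong (_∷ʳ east) (frontier-∷ b m μ) ⟨
  frontier b (m ∷ μ) ∷ʳ east ∎

linked⇒≤head : ∀ {μ : Vec ℕ k} → Linked ℕ._≥_ (m ∷ μ) → VecAll.All (ℕ._≤ m) μ
linked⇒≤head {μ = []}    _          = []
linked⇒≤head {μ = _ ∷ _} (x≤m ∷ μ↘) = x≤m ∷ VecAll.map (λ y≤x → ℕ.≤-trans y≤x x≤m) (linked⇒≤head μ↘)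

inBox-∷⁻ : ∀ {μ : Vec ℕ k} → InBox b (m ∷ μ) → m ℕ.≤ b × InBox m μ
inBox-∷⁻ (m≤b ∷ _ , m∷μ↘) = m≤b , linked⇒≤head m∷μ↘ , Linked.tail m∷μ↘

inBox-∷⁺ : ∀ {μ : Vec ℕ k} → m ℕ.≤ b → InBox m μ → InBox b (m ∷ μ)
inBox-∷⁺ {μ = []}    m≤b _                  = m≤b ∷ [] , [-]
inBox-∷⁺ {μ = x ∷ μ} m≤b (x≤m ∷ μ≤m , μ↘) =
  m≤b ∷ VecAll.map (λ y≤m → ℕ.≤-trans y≤m m≤b) (x≤m ∷ μ≤m) , x≤m ∷ μ↘

-- The constructors retrace the steps of the frontier.
data Box : ∀ {k} → ℕ → Vec ℕ k → Set where
  start : Box 0 []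
  east  : ∀ {k b} {μ : Vec ℕ k} → Box b μ → Box (suc b) μ
  north : ∀ {k b} {μ : Vec ℕ k} → Box b μ → Box b (b ∷ μ)

box-≤ : ∀ {μ : Vec ℕ k} → Box b μ → VecAll.All (ℕ._≤ b) μ
box-≤ start     = []
box-≤ (east β)  = VecAll.map ℕ.m≤n⇒m≤1+n (box-≤ β)
box-≤ (north β) = ℕ.≤-refl ∷ box-≤ β

box-weaken : ∀ {μ : Vec ℕ k} → m ℕ.≤′ b → Box m μ → Box b μ
box-weaken (ℕ.≤′-reflexive refl) β = β
box-weaken (ℕ.≤′-step m≤b)       β = east (box-weaken m≤b β)

inBox⇒box : ∀ (μ : Vec ℕ k) → InBox b μ → Box b μ
inBox⇒box []      _ = box-weaken (ℕ.≤⇒≤′ ℕ.z≤n) start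
inBox⇒box (m ∷ μ) p with inBox-∷⁻ p
... | m≤b , q = box-weaken (ℕ.≤⇒≤′ m≤b) (north (inBox⇒box μ q))

-- The partitions in a box of width b, listed among the vectors with entries below B.
sumBox : ∀ B b k → (Vec ℕ k → ℤ) → ℤ
sumBox B b k g = sum (vectors (upTo B) k) λ μ → 𝟙 (inBox? b μ) ℤ.* g μ

sumBox-∷ : ∀ B b k g →
  sumBox B b (suc k) g ≡ sum (upTo B) λ m → 𝟙 (m ℕ.≤? b) ℤ.* sumBox B m k (g ∘ (m ∷_))
sumBox-∷ B b k g = trans (sum-cartesianProductWith _∷_ (upTo B) (vectors (upTo B) k) _)
  (sum-cong (upTo B) λ m → trans
    (sum-cong (vectors (upTo B) k) λ μ → begin
      𝟙 (inBox? b (m ∷ μ)) ℤ.* g (m ∷ μ)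
        ≡⟨ cong (ℤ._* g (m ∷ μ)) (𝟙-cong (inBox? b (m ∷ μ)) (m ℕ.≤? b ×-dec inBox? m μ)
             inBox-∷⁻ (λ (m≤b , p) → inBox-∷⁺ m≤b p)) ⟩
      𝟙 (m ℕ.≤? b ×-dec inBox? m μ) ℤ.* g (m ∷ μ)
        ≡⟨ cong (ℤ._* g (m ∷ μ)) (𝟙-×-dec (m ℕ.≤? b) (inBox? m μ)) ⟩
      𝟙 (m ℕ.≤? b) ℤ.* 𝟙 (inBox? m μ) ℤ.* g (m ∷ μ)
        ≡⟨ ℤ.*-assoc (𝟙 (m ℕ.≤? b)) (𝟙 (inBox? m μ)) (g (m ∷ μ)) ⟩
      𝟙 (m ℕ.≤? b) ℤ.* (𝟙 (inBox? m μ) ℤ.* g (m ∷ μ)) ∎)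
    (sum-* (vectors (upTo B) k) (𝟙 (m ℕ.≤? b)) λ μ → 𝟙 (inBox? m μ) ℤ.* g (m ∷ μ)))

𝟙-≤-suc : ∀ m b → 𝟙 (m ℕ.≤? suc b) ≡ 𝟙 (m ℕ.≤? b) ℤ.+ 𝟙 (m ℕ.≟ suc b)
𝟙-≤-suc m b = go (m ℕ.≟ suc b)
  where
  go : Dec (m ≡ suc b) → 𝟙 (m ℕ.≤? suc b) ≡ 𝟙 (m ℕ.≤? b) ℤ.+ 𝟙 (m ℕ.≟ suc b)
  go (yes refl) = trans (𝟙-yes (suc b ℕ.≤? suc b) ℕ.≤-refl)
    (sym (cong₂ ℤ._+_ (𝟙-no (suc b ℕ.≤? b) (ℕ.<⇒≱ ℕ.≤-refl)) (𝟙-yes (suc b ℕ.≟ suc b) refl)))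
  go (no m≢) = begin
    𝟙 (m ℕ.≤? suc b)
      ≡⟨ 𝟙-cong (m ℕ.≤? suc b) (m ℕ.≤? b) (λ m≤ → ℕ.≤-pred (ℕ.≤∧≢⇒< m≤ m≢)) ℕ.m≤n⇒m≤1+n ⟩
    𝟙 (m ℕ.≤? b)
      ≡⟨ ℤ.+-identityʳ _ ⟨
    𝟙 (m ℕ.≤? b) ℤ.+ 0ℤ
      ≡⟨ cong (λ z → 𝟙 (m ℕ.≤? b) ℤ.+ z) (𝟙-no (m ℕ.≟ suc b) m≢) ⟨
    𝟙 (m ℕ.≤? b) ℤ.+ 𝟙 (m ℕ.≟ suc b) ∎

-- Either the largest part is smaller than `suc b` and the box can be narrowed, or it equals `suc b`
-- and its row can be removed. On the frontier these are a last step east and a last step north.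
sumBox-suc : ∀ {B b} k g → suc b ℕ.< B →
  sumBox B (suc b) (suc k) g ≡ sumBox B b (suc k) g ℤ.+ sumBox B (suc b) k (g ∘ (suc b ∷_))
sumBox-suc {B} {b} k g b<B = begin
  sumBox B (suc b) (suc k) g
    ≡⟨ sumBox-∷ B (suc b) k g ⟩
  sum (upTo B) (λ m → 𝟙 (m ℕ.≤? suc b) ℤ.* rest m)
    ≡⟨ sum-cong (upTo B) (λ m → trans (cong (ℤ._* rest m) (𝟙-≤-suc m b))
         (ℤ.*-distribʳ-+ (rest m) (𝟙 (m ℕ.≤? b)) (𝟙 (m ℕ.≟ suc b)))) ⟩
  sum (upTo B) (λ m → 𝟙 (m ℕ.≤? b) ℤ.* rest m ℤ.+ 𝟙 (m ℕ.≟ suc b) ℤ.* rest m)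
    ≡⟨ sum-+ (upTo B) (λ m → 𝟙 (m ℕ.≤? b) ℤ.* rest m) (λ m → 𝟙 (m ℕ.≟ suc b) ℤ.* rest m) ⟩
  sum (upTo B) (λ m → 𝟙 (m ℕ.≤? b) ℤ.* rest m) ℤ.+ sum (upTo B) (λ m → 𝟙 (m ℕ.≟ suc b) ℤ.* rest m)
    ≡⟨ cong₂ ℤ._+_ (sumBox-∷ B b k g) (sym (sum-upTo-𝟙≟ (suc b) rest b<B)) ⟨
  sumBox B b (suc k) g ℤ.+ rest (suc b) ∎
  where
  rest : ℕ → ℤ
  rest m = sumBox B m k (g ∘ (m ∷_))

sumBox-zero : ∀ {B} k g → 0 ℕ.< B → sumBox B 0 (suc k) g ≡ sumBox B 0 k (g ∘ (0 ∷_))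
sumBox-zero {B} k g 0<B = begin
  sumBox B 0 (suc k) g
    ≡⟨ sumBox-∷ B 0 k g ⟩
  sum (upTo B) (λ m → 𝟙 (m ℕ.≤? 0) ℤ.* rest m)
    ≡⟨ sum-cong (upTo B) (λ m → cong (ℤ._* rest m)
         (𝟙-cong (m ℕ.≤? 0) (m ℕ.≟ 0) ℕ.n≤0⇒n≡0 ℕ.≤-reflexive)) ⟩
  sum (upTo B) (λ m → 𝟙 (m ℕ.≟ 0) ℤ.* rest m)
    ≡⟨ sum-upTo-𝟙≟ 0 rest 0<B ⟩
  rest 0 ∎
  where
  rest : ℕ → ℤ
  rest m = sumBox B m k (g ∘ (m ∷_))

sumBox-cong : ∀ B b k {g h : Vec ℕ k → ℤ} → (∀ μ → InBox b μ → g μ ≡ h μ) → sumBox B b k g ≡ sumBox B b k h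
sumBox-cong B b k eq = sum-cong (vectors (upTo B) k) λ μ → 𝟙-*-cong (inBox? b μ) (eq μ)

-- Partitions and words obey the same Pascal recursion on the last step of the frontier, so the two
-- sums agree by induction and no inverse of `frontier` has to be constructed.
sumBox-frontier : ∀ {B} k b (f : Word → ℤ) → b ℕ.< B →
  sumBox B b k (f ∘ frontier b) ≡ sumN (k + b) k f
sumBox-frontier zero b f b<B = begin
  𝟙 (inBox? b []) ℤ.* f (replicate b east) ℤ.+ 0ℤ ≡⟨ ℤ.+-identityʳ _ ⟩
  𝟙 (inBox? b []) ℤ.* f (replicate b east)        ≡⟨ cong (ℤ._* f (replicate b east)) (𝟙-yes (inBox? b []) ([] , [])) ⟩
  1ℤ ℤ.* f (replicate b east)                     ≡⟨ ℤ.*-identityˡ _ ⟩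
  f (replicate b east)                            ≡⟨ sumN-0 b f ⟨
  sumN b 0 f ∎
sumBox-frontier {B} (suc k) zero f b<B = begin
  sumBox B 0 (suc k) (f ∘ frontier 0)
    ≡⟨ sumBox-zero k (f ∘ frontier 0) b<B ⟩
  sumBox B 0 k (λ μ → f (frontier 0 (0 ∷ μ)))
    ≡⟨ sumBox-cong B 0 k (λ μ _ → cong f (frontier-north 0 μ)) ⟩
  sumBox B 0 k (λ μ → f (frontier 0 μ ∷ʳ north))
    ≡⟨ sumBox-frontier k 0 (f ∘ (_∷ʳ north)) b<B ⟩
  sumN (k + 0) k (f ∘ (_∷ʳ north))
    -- The word recursion also has a branch ending in an east step, with no counterpart in a box of
    -- width 0. It is empty, because k steps cannot contain k + 1 norths.
    ≡⟨ ℤ.+-identityʳ _ ⟨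
  sumN (k + 0) k (f ∘ (_∷ʳ north)) ℤ.+ 0ℤ
    ≡⟨ cong (λ z → sumN (k + 0) k (f ∘ (_∷ʳ north)) ℤ.+ z)
         (sumN-> (ℕ.s≤s (ℕ.≤-reflexive (ℕ.+-identityʳ k))) (f ∘ (_∷ʳ east))) ⟨
  sumN (k + 0) k (f ∘ (_∷ʳ north)) ℤ.+ sumN (k + 0) (suc k) (f ∘ (_∷ʳ east))
    ≡⟨ sumN-∷ʳ (k + 0) k f ⟨
  sumN (suc k + 0) (suc k) f ∎
sumBox-frontier {B} (suc k) (suc b) f b<B = begin
  sumBox B (suc b) (suc k) (f ∘ frontier (suc b))
    ≡⟨ sumBox-suc k (f ∘ frontier (suc b)) b<B ⟩
  sumBox B b (suc k) (λ μ → f (frontier (suc b) μ)) ℤ.+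
  sumBox B (suc b) k (λ μ → f (frontier (suc b) (suc b ∷ μ)))
    ≡⟨ cong₂ ℤ._+_
         (sumBox-cong B b (suc k) λ μ p → cong f (frontier-east (proj₁ p)))
         (sumBox-cong B (suc b) k λ μ _ → cong f (frontier-north (suc b) μ)) ⟩
  sumBox B b (suc k) (λ μ → f (frontier b μ ∷ʳ east)) ℤ.+
  sumBox B (suc b) k (λ μ → f (frontier (suc b) μ ∷ʳ north))
    ≡⟨ cong₂ ℤ._+_ (sumBox-frontier (suc k) b (f ∘ (_∷ʳ east)) (ℕ.<⇒≤ b<B))
                   (sumBox-frontier k (suc b) (f ∘ (_∷ʳ north)) b<B) ⟩
  sumN (suc k + b) (suc k) (f ∘ (_∷ʳ east)) ℤ.+ sumN (k + suc b) k (f ∘ (_∷ʳ north))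
    ≡⟨ ℤ.+-comm (sumN (suc k + b) (suc k) (f ∘ (_∷ʳ east))) _ ⟩
  sumN (k + suc b) k (f ∘ (_∷ʳ north)) ℤ.+ sumN (suc k + b) (suc k) (f ∘ (_∷ʳ east))
    ≡⟨ cong (λ n → sumN (k + suc b) k (f ∘ (_∷ʳ north)) ℤ.+ sumN n (suc k) (f ∘ (_∷ʳ east))) (ℕ.+-suc k b) ⟨
  sumN (k + suc b) k (f ∘ (_∷ʳ north)) ℤ.+ sumN (k + suc b) (suc k) (f ∘ (_∷ʳ east))
    ≡⟨ sumN-∷ʳ (k + suc b) k f ⟨
  sumN (suc k + suc b) (suc k) f ∎

sum-R : ∀ a b (f : Word → ℤ) → sum (R a b) (f ∘ frontier b) ≡ sum (balanced a b) f
sum-R a b f = begin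
  sum (R a b) (f ∘ frontier b)
    ≡⟨ sum-filter (inBox? b) (vectors (upTo (suc b)) a) (f ∘ frontier b) ⟩
  sumBox (suc b) b a (f ∘ frontier b)
    ≡⟨ sumBox-frontier a b f ℕ.≤-refl ⟩
  sumN (a + b) a f
    ≡⟨ sumN≡sum-balanced a b f ⟨
  sum (balanced a b) f ∎

-- Statistics of words

module _ (a b : ℕ) where

  n : ℤ
  n = + a ℤ.+ + b

  wt : Step → ℤ
  wt north = + b
  wt east  = - (+ a)

  weight : Word → ℤ
  weight []      = 0ℤ
  weight (s ∷ w) = wt s ℤ.+ weight w

  weight-++ : ∀ u v → weight (u ++ v) ≡ weight u ℤ.+ weight v
  weight-++ []      v = sym (ℤ.+-identityˡ _)
  weight-++ (s ∷ u) v = trans (cong (λ z → wt s ℤ.+ z) (weight-++ u v)) (sym (ℤ.+-assoc (wt s) _ _))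

  weight-∷ʳ : ∀ w s → weight (w ∷ʳ s) ≡ weight w ℤ.+ wt s
  weight-∷ʳ w s = trans (weight-++ w (s ∷ [])) (cong (λ z → weight w ℤ.+ z) (ℤ.+-identityʳ (wt s)))

  weight-counts : ∀ w → weight w ≡ + b ℤ.* + #N w - + a ℤ.* + #E w
  weight-counts []          = sym (cong₂ _-_ (ℤ.*-zeroʳ (+ b)) (ℤ.*-zeroʳ (+ a)))
  weight-counts (north ∷ w) = trans (cong (λ z → + b ℤ.+ z) (weight-counts w)) (lemma (+ a) (+ b) (+ #N w) (+ #E w))
    where
    lemma : ∀ a b x y → b ℤ.+ (b ℤ.* x - a ℤ.* y) ≡ b ℤ.* (1ℤ ℤ.+ x) - a ℤ.* y
    lemma = solve-∀
  weight-counts (east ∷ w)  = trans (cong (λ z → - (+ a) ℤ.+ z) (weight-counts w)) (lemma (+ a) (+ b) (+ #N w) (+ #E w))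
    where
    lemma : ∀ a b x y → - a ℤ.+ (b ℤ.* x - a ℤ.* y) ≡ b ℤ.* x - a ℤ.* (1ℤ ℤ.+ y)
    lemma = solve-∀

  Balanced : Word → Set
  Balanced w = #N w ≡ a × #E w ≡ b

  balanced-weight : ∀ w → Balanced w → weight w ≡ 0ℤ
  balanced-weight w (refl , refl) = trans (weight-counts w) (lemma (+ a) (+ b))
    where
    lemma : ∀ a b → b ℤ.* a - a ℤ.* b ≡ 0ℤ
    lemma = solve-∀

  -- Sums over the steps s of w, x being the level from which s departs when w departs from l.
  stepSum : (Step → ℤ → ℤ) → ℤ → Word → ℤ
  stepSum φ l []      = 0ℤ
  stepSum φ l (s ∷ w) = φ s l ℤ.+ stepSum φ (l ℤ.+ wt s) w

  -- The end point is left out: on a closed path it would repeat the start and spoil distinctness.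
  levels : ℤ → Word → List ℤ
  levels l []      = []
  levels l (s ∷ w) = l ∷ levels (l ℤ.+ wt s) w

  length-levels : ∀ l w → length (levels l w) ≡ length w
  length-levels l []      = refl
  length-levels l (s ∷ w) = cong suc (length-levels (l ℤ.+ wt s) w)

  stepSum-levels : ∀ f l w → stepSum (λ _ → f) l w ≡ sum (levels l w) f
  stepSum-levels f l []      = refl
  stepSum-levels f l (s ∷ w) = cong (λ z → f l ℤ.+ z) (stepSum-levels f (l ℤ.+ wt s) w)

  stepSum-cong-levels : ∀ {P : ℤ → Set} {φ ψ} → (∀ s x → P x → φ s x ≡ ψ s x) →
    ∀ l w → All P (levels l w) → stepSum φ l w ≡ stepSum ψ l w
  stepSum-cong-levels eq l []      []       = refl
  stepSum-cong-levels eq l (s ∷ w) (p ∷ ps) = cong₂ ℤ._+_ (eq s l p) (stepSum-cong-levels eq (l ℤ.+ wt s) w ps)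

  stepSum-cong : ∀ {φ ψ} → (∀ s x → φ s x ≡ ψ s x) → ∀ l w → stepSum φ l w ≡ stepSum ψ l w
  stepSum-cong eq l []      = refl
  stepSum-cong eq l (s ∷ w) = cong₂ ℤ._+_ (eq s l) (stepSum-cong eq (l ℤ.+ wt s) w)

  stepSum-+ : ∀ φ ψ l w → stepSum (λ s x → φ s x ℤ.+ ψ s x) l w ≡ stepSum φ l w ℤ.+ stepSum ψ l w
  stepSum-+ φ ψ l []      = refl
  stepSum-+ φ ψ l (s ∷ w) = trans (cong (λ z → φ s l ℤ.+ ψ s l ℤ.+ z) (stepSum-+ φ ψ (l ℤ.+ wt s) w))
    (interchange (φ s l) (ψ s l) _ _)

  stepSum-shift : ∀ φ k l w → stepSum φ (l ℤ.+ k) w ≡ stepSum (λ s x → φ s (x ℤ.+ k)) l w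
  stepSum-shift φ k l []      = refl
  stepSum-shift φ k l (s ∷ w) = cong (λ z → φ s (l ℤ.+ k) ℤ.+ z) (trans
    (cong (λ x → stepSum φ x w) (lemma l k (wt s))) (stepSum-shift φ k (l ℤ.+ wt s) w))
    where
    lemma : ∀ l k x → l ℤ.+ k ℤ.+ x ≡ l ℤ.+ x ℤ.+ k
    lemma = solve-∀

  stepSum-++ : ∀ φ l u v → stepSum φ l (u ++ v) ≡ stepSum φ l u ℤ.+ stepSum φ (l ℤ.+ weight u) v
  stepSum-++ φ l []      v = trans (cong (λ x → stepSum φ x v) (sym (ℤ.+-identityʳ l))) (sym (ℤ.+-identityˡ _))
  stepSum-++ φ l (s ∷ u) v = begin
    φ s l ℤ.+ stepSum φ (l ℤ.+ wt s) (u ++ v)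
      ≡⟨ cong (λ z → φ s l ℤ.+ z) (stepSum-++ φ (l ℤ.+ wt s) u v) ⟩
    φ s l ℤ.+ (stepSum φ (l ℤ.+ wt s) u ℤ.+ stepSum φ (l ℤ.+ wt s ℤ.+ weight u) v)
      ≡⟨ ℤ.+-assoc (φ s l) _ _ ⟨
    stepSum φ l (s ∷ u) ℤ.+ stepSum φ (l ℤ.+ wt s ℤ.+ weight u) v
      ≡⟨ cong (λ x → stepSum φ l (s ∷ u) ℤ.+ stepSum φ x v) (ℤ.+-assoc l (wt s) (weight u)) ⟩
    stepSum φ l (s ∷ u) ℤ.+ stepSum φ (l ℤ.+ weight (s ∷ u)) v ∎

  stepSum-∷ʳ : ∀ φ l w s → stepSum φ l (w ∷ʳ s) ≡ stepSum φ l w ℤ.+ φ s (l ℤ.+ weight w)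
  stepSum-∷ʳ φ l w s = trans (stepSum-++ φ l w (s ∷ []))
    (cong (λ z → stepSum φ l w ℤ.+ z) (ℤ.+-identityʳ (φ s (l ℤ.+ weight w))))

  stepSum-telescope : ∀ (g : ℤ → ℤ) l w →
    stepSum (λ s x → g (x ℤ.+ wt s) - g x) l w ≡ g (l ℤ.+ weight w) - g l
  stepSum-telescope g l []      = sym (ℤ.i≡j⇒i-j≡0 {i = g (l ℤ.+ 0ℤ)} {j = g l} (cong g (ℤ.+-identityʳ l)))
  stepSum-telescope g l (s ∷ w) = begin
    g (l ℤ.+ wt s) - g l ℤ.+ stepSum (λ s x → g (x ℤ.+ wt s) - g x) (l ℤ.+ wt s) w
      ≡⟨ cong (λ z → g (l ℤ.+ wt s) - g l ℤ.+ z) (stepSum-telescope g (l ℤ.+ wt s) w) ⟩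
    g (l ℤ.+ wt s) - g l ℤ.+ (g (l ℤ.+ wt s ℤ.+ weight w) - g (l ℤ.+ wt s))
      ≡⟨ lemma (g (l ℤ.+ wt s)) (g l) (g (l ℤ.+ wt s ℤ.+ weight w)) ⟩
    g (l ℤ.+ wt s ℤ.+ weight w) - g l
      ≡⟨ cong (λ x → g x - g l) (ℤ.+-assoc l (wt s) (weight w)) ⟩
    g (l ℤ.+ weight (s ∷ w)) - g l ∎
    where
    lemma : ∀ x y z → x - y ℤ.+ (z - x) ≡ z - y
    lemma = solve-∀

  module _ (s : Step) (w : Word) (closed : weight (s ∷ w) ≡ 0ℤ) where

    weight-tail : weight w ≡ - wt s
    weight-tail = trans (lemma (wt s) (weight w)) (trans (cong (λ z → z - wt s) closed) (ℤ.+-identityˡ _))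
      where
      lemma : ∀ x y → y ≡ x ℤ.+ y - x
      lemma = solve-∀

    -- A closed path and its rotation visit the same points in the same cyclic order. Starting one
    -- step later lowers all levels by `wt s`, and the moved step departs from the old start, now at
    -- level `- wt s`.
    stepSum-rot : ∀ φ → stepSum φ 0ℤ (w ∷ʳ s) ≡ stepSum (λ t x → φ t (x - wt s)) 0ℤ (s ∷ w)
    stepSum-rot φ = begin
      stepSum φ 0ℤ (w ∷ʳ s)
        ≡⟨ stepSum-∷ʳ φ 0ℤ w s ⟩
      stepSum φ 0ℤ w ℤ.+ φ s (0ℤ ℤ.+ weight w)
        ≡⟨ cong₂ ℤ._+_ (stepSum-cong (λ t x → cong (φ t) (lemma x (wt s))) 0ℤ w)
                       (cong (λ x → φ s (0ℤ ℤ.+ x)) weight-tail) ⟩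
      stepSum (λ t x → φ t (x ℤ.+ wt s - wt s)) 0ℤ w ℤ.+ φ s (0ℤ - wt s)
        ≡⟨ cong (ℤ._+ φ s (0ℤ - wt s)) (stepSum-shift (λ t x → φ t (x - wt s)) (wt s) 0ℤ w) ⟨
      stepSum (λ t x → φ t (x - wt s)) (0ℤ ℤ.+ wt s) w ℤ.+ φ s (0ℤ - wt s)
        ≡⟨ ℤ.+-comm _ (φ s (0ℤ - wt s)) ⟩
      stepSum (λ t x → φ t (x - wt s)) 0ℤ (s ∷ w) ∎
      where
      lemma : ∀ x y → x ≡ x ℤ.+ y - y
      lemma = solve-∀

  onNorth onEast : (ℤ → ℤ) → Step → ℤ → ℤ
  onNorth f north x = f x
  onNorth f east  x = 0ℤ
  onEast f north x = 0ℤ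
  onEast f east  x = f x

  stepSum-onNorth-1 : ∀ l w → stepSum (onNorth λ _ → 1ℤ) l w ≡ + #N w
  stepSum-onNorth-1 l []          = refl
  stepSum-onNorth-1 l (north ∷ w) = cong (λ z → 1ℤ ℤ.+ z) (stepSum-onNorth-1 (l ℤ.+ wt north) w)
  stepSum-onNorth-1 l (east ∷ w)  = trans (ℤ.+-identityˡ _) (stepSum-onNorth-1 (l ℤ.+ wt east) w)

  stepSum-onEast-1 : ∀ l w → stepSum (onEast λ _ → 1ℤ) l w ≡ + #E w
  stepSum-onEast-1 l []          = refl
  stepSum-onEast-1 l (north ∷ w) = trans (ℤ.+-identityˡ _) (stepSum-onEast-1 (l ℤ.+ wt north) w)
  stepSum-onEast-1 l (east ∷ w)  = cong (λ z → 1ℤ ℤ.+ z) (stepSum-onEast-1 (l ℤ.+ wt east) w)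

  -- The pairs of an east step before a north step correspond to the cells above the path;
  -- P is applied to the drop in level from the start of the east step to the start of the north step.
  pairs : (ℤ → ℤ) → Word → ℤ
  pairs P []          = 0ℤ
  pairs P (north ∷ w) = pairs P w
  pairs P (east ∷ w)  = pairs P w ℤ.+ stepSum (onNorth (P ∘ -_)) (wt east) w

  -- The cells that one more north step at the end would create: `P` is applied to the drop from
  -- each east step to the end of the word.
  easts : (ℤ → ℤ) → Word → ℤ
  easts P []          = 0ℤ
  easts P (north ∷ w) = easts P w
  easts P (east ∷ w)  = P (- weight (east ∷ w)) ℤ.+ easts P w

  easts-∷ʳ-north : ∀ P w → easts P (w ∷ʳ north) ≡ easts (λ x → P (x - + b)) w
  easts-∷ʳ-north P []          = refl
  easts-∷ʳ-north P (north ∷ w) = easts-∷ʳ-north P w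
  easts-∷ʳ-north P (east ∷ w)  = cong₂ ℤ._+_
    (cong P (trans (cong -_ (weight-∷ʳ (east ∷ w) north)) (ℤ.neg-distrib-+ (weight (east ∷ w)) (+ b))))
    (easts-∷ʳ-north P w)

  easts-∷ʳ-east : ∀ P w → easts P (w ∷ʳ east) ≡ easts (λ x → P (x ℤ.+ + a)) w ℤ.+ P (+ a)
  easts-∷ʳ-east P []          = trans (ℤ.+-comm (P (- (- (+ a) ℤ.+ 0ℤ))) 0ℤ)
    (cong (λ x → 0ℤ ℤ.+ P x) (trans (cong -_ (ℤ.+-identityʳ (- (+ a)))) (ℤ.neg-involutive (+ a))))
  easts-∷ʳ-east P (north ∷ w) = easts-∷ʳ-east P w
  easts-∷ʳ-east P (east ∷ w)  = trans
    (cong₂ ℤ._+_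
      (cong P (trans (cong -_ (weight-∷ʳ (east ∷ w) east)) (lemma (weight (east ∷ w)) (+ a))))
      (easts-∷ʳ-east P w))
    (sym (ℤ.+-assoc (P (- weight (east ∷ w) ℤ.+ + a)) _ _))
    where
    lemma : ∀ x a → - (x ℤ.+ - a) ≡ - x ℤ.+ a
    lemma = solve-∀

  -- Trades the drop to the end of the path, suited to recursion on the word, for the level of
  -- departure, which the rotation argument compares with thresholds.
  easts≡stepSum : ∀ P l w → easts P w ≡ stepSum (onEast λ x → P (x - (l ℤ.+ weight w))) l w
  easts≡stepSum P l []          = refl
  easts≡stepSum P l (north ∷ w) = begin
    easts P w
      ≡⟨ easts≡stepSum P (l ℤ.+ + b) w ⟩
    stepSum (onEast λ x → P (x - (l ℤ.+ + b ℤ.+ weight w))) (l ℤ.+ + b) w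
      ≡⟨ cong (λ e → stepSum (onEast λ x → P (x - e)) (l ℤ.+ + b) w) (ℤ.+-assoc l (+ b) (weight w)) ⟩
    stepSum (onEast λ x → P (x - (l ℤ.+ weight (north ∷ w)))) (l ℤ.+ + b) w
      ≡⟨ ℤ.+-identityˡ _ ⟨
    stepSum (onEast λ x → P (x - (l ℤ.+ weight (north ∷ w)))) l (north ∷ w) ∎
  easts≡stepSum P l (east ∷ w)  = cong₂ ℤ._+_ (cong P (lemma l (weight (east ∷ w))))
    (trans (easts≡stepSum P (l ℤ.+ - (+ a)) w)
      (cong (λ e → stepSum (onEast λ x → P (x - e)) (l ℤ.+ - (+ a)) w) (ℤ.+-assoc l (- (+ a)) (weight w))))
    where
    lemma : ∀ l x → - x ≡ l - (l ℤ.+ x)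
    lemma = solve-∀

  pairs-∷ʳ-east : ∀ P w → pairs P (w ∷ʳ east) ≡ pairs P w
  pairs-∷ʳ-east P []          = refl
  pairs-∷ʳ-east P (north ∷ w) = pairs-∷ʳ-east P w
  pairs-∷ʳ-east P (east ∷ w)  = cong₂ ℤ._+_ (pairs-∷ʳ-east P w)
    (trans (stepSum-∷ʳ (onNorth (P ∘ -_)) (wt east) w east) (ℤ.+-identityʳ _))

  pairs-∷ʳ-north : ∀ P w → pairs P (w ∷ʳ north) ≡ pairs P w ℤ.+ easts P w
  pairs-∷ʳ-north P []          = refl
  pairs-∷ʳ-north P (north ∷ w) = pairs-∷ʳ-north P w
  pairs-∷ʳ-north P (east ∷ w)  = begin
    pairs P (w ∷ʳ north) ℤ.+ stepSum φ (wt east) (w ∷ʳ north)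
      ≡⟨ cong₂ ℤ._+_ (pairs-∷ʳ-north P w) (stepSum-∷ʳ φ (wt east) w north) ⟩
    pairs P w ℤ.+ easts P w ℤ.+ (stepSum φ (wt east) w ℤ.+ P (- weight (east ∷ w)))
      ≡⟨ lemma (pairs P w) (easts P w) (stepSum φ (wt east) w) (P (- weight (east ∷ w))) ⟩
    pairs P (east ∷ w) ℤ.+ easts P (east ∷ w) ∎
    where
    φ = onNorth (P ∘ -_)

    lemma : ∀ p e s q → p ℤ.+ e ℤ.+ (s ℤ.+ q) ≡ p ℤ.+ s ℤ.+ (q ℤ.+ e)
    lemma = solve-∀

  -- Unlike `levels`, this includes the end point, as `ml` does.
  minLevel : ℤ → Word → ℤ
  minLevel l []      = l
  minLevel l (s ∷ w) = l ℤ.⊓ minLevel (l ℤ.+ wt s) w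

  minLevel-shift : ∀ k l w → minLevel (l ℤ.+ k) w ≡ minLevel l w ℤ.+ k
  minLevel-shift k l []      = refl
  minLevel-shift k l (s ∷ w) = begin
    (l ℤ.+ k) ℤ.⊓ minLevel (l ℤ.+ k ℤ.+ wt s) w
      ≡⟨ cong (λ x → (l ℤ.+ k) ℤ.⊓ minLevel x w) (lemma l k (wt s)) ⟩
    (l ℤ.+ k) ℤ.⊓ minLevel (l ℤ.+ wt s ℤ.+ k) w
      ≡⟨ cong ((l ℤ.+ k) ℤ.⊓_) (minLevel-shift k (l ℤ.+ wt s) w) ⟩
    (l ℤ.+ k) ℤ.⊓ (minLevel (l ℤ.+ wt s) w ℤ.+ k)
      ≡⟨ ℤ.mono-≤-distrib-⊓ (ℤ.+-monoˡ-≤ k) l (minLevel (l ℤ.+ wt s) w) ⟨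
    minLevel l (s ∷ w) ℤ.+ k ∎
    where
    lemma : ∀ l k x → l ℤ.+ k ℤ.+ x ≡ l ℤ.+ x ℤ.+ k
    lemma = solve-∀

  minLevel-∷ʳ : ∀ l w s → minLevel l (w ∷ʳ s) ≡ minLevel l w ℤ.⊓ (l ℤ.+ weight (w ∷ʳ s))
  minLevel-∷ʳ l []      s = cong (λ x → l ℤ.⊓ (l ℤ.+ x)) (sym (ℤ.+-identityʳ (wt s)))
  minLevel-∷ʳ l (t ∷ w) s = begin
    l ℤ.⊓ minLevel (l ℤ.+ wt t) (w ∷ʳ s)
      ≡⟨ cong (l ℤ.⊓_) (minLevel-∷ʳ (l ℤ.+ wt t) w s) ⟩
    l ℤ.⊓ (minLevel (l ℤ.+ wt t) w ℤ.⊓ (l ℤ.+ wt t ℤ.+ weight (w ∷ʳ s)))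
      ≡⟨ ℤ.⊓-assoc l _ _ ⟨
    minLevel l (t ∷ w) ℤ.⊓ (l ℤ.+ wt t ℤ.+ weight (w ∷ʳ s))
      ≡⟨ cong (minLevel l (t ∷ w) ℤ.⊓_) (ℤ.+-assoc l (wt t) (weight (w ∷ʳ s))) ⟩
    minLevel l (t ∷ w) ℤ.⊓ (l ℤ.+ weight (t ∷ w ∷ʳ s)) ∎

  minLevel≤start : ∀ l w → minLevel l w ℤ.≤ l
  minLevel≤start l []      = ℤ.≤-refl
  minLevel≤start l (s ∷ w) = ℤ.i⊓j≤i l _

  minLevel≤end : ∀ l w → minLevel l w ℤ.≤ l ℤ.+ weight w
  minLevel≤end l []      = ℤ.≤-reflexive (sym (ℤ.+-identityʳ l))
  minLevel≤end l (s ∷ w) = ℤ.≤-trans (ℤ.i⊓j≤j l _)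
    (ℤ.≤-trans (minLevel≤end (l ℤ.+ wt s) w) (ℤ.≤-reflexive (ℤ.+-assoc l (wt s) (weight w))))

  minLevel-rot : ∀ s w → weight (s ∷ w) ≡ 0ℤ → minLevel 0ℤ (s ∷ w) ≡ minLevel 0ℤ (w ∷ʳ s) ℤ.+ wt s
  minLevel-rot s w closed = begin
    0ℤ ℤ.⊓ minLevel (0ℤ ℤ.+ wt s) w
      ≡⟨ ℤ.i≥j⇒i⊓j≡j (subst (minLevel (0ℤ ℤ.+ wt s) w ℤ.≤_) end≡0 (minLevel≤end (0ℤ ℤ.+ wt s) w)) ⟩
    minLevel (0ℤ ℤ.+ wt s) w
      ≡⟨ minLevel-shift (wt s) 0ℤ w ⟩
    minLevel 0ℤ w ℤ.+ wt s
      ≡⟨ cong (ℤ._+ wt s) (ℤ.i≤j⇒i⊓j≡i (minLevel≤start 0ℤ w)) ⟨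
    minLevel 0ℤ w ℤ.⊓ 0ℤ ℤ.+ wt s
      ≡⟨ cong (λ x → minLevel 0ℤ w ℤ.⊓ x ℤ.+ wt s) (trans (ℤ.+-identityˡ _)
           (trans (weight-∷ʳ w s) (trans (ℤ.+-comm (weight w) (wt s)) closed))) ⟨
    minLevel 0ℤ w ℤ.⊓ (0ℤ ℤ.+ weight (w ∷ʳ s)) ℤ.+ wt s
      ≡⟨ cong (ℤ._+ wt s) (minLevel-∷ʳ 0ℤ w s) ⟨
    minLevel 0ℤ (w ∷ʳ s) ℤ.+ wt s ∎
    where
    end≡0 : 0ℤ ℤ.+ wt s ℤ.+ weight w ≡ 0ℤ
    end≡0 = trans (ℤ.+-assoc 0ℤ (wt s) (weight w)) (trans (ℤ.+-identityˡ _) closed)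

  -- The invariant of rotation

  P⁺ P⁻ : ℤ → ℤ
  P⁺ d = 𝟙 (0ℤ ℤ.<? d) - 𝟙 (n ℤ.<? d)
  P⁻ d = 𝟙 (d ℤ.<? n) - 𝟙 (d ℤ.<? 0ℤ)

  below : Word → ℤ
  below w = stepSum (λ _ x → 𝟙 (x ℤ.<? 0ℤ)) 0ℤ w

  stat : (ℤ → ℤ) → Word → ℤ
  stat P w = pairs (λ _ → 1ℤ) w ℤ.+ minLevel 0ℤ w ℤ.+ pairs P w

  -- `P` remains a parameter because the two kinds of rotation are treated with different choices of
  -- it.
  base : (ℤ → ℤ) → Word → ℤ
  base P w = stat P w - below w

  -- The levels below 0 are compared before and after the rotation by a telescoping sum:
  -- x ↦ 𝟙 (x < b) has net change 0 along a closed path.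
  below-rot-north : ∀ w → weight (north ∷ w) ≡ 0ℤ →
    below (w ∷ʳ north) ≡ below (north ∷ w) ℤ.+ easts P⁻ w
  below-rot-north w closed = begin
    below (w ∷ʳ north)
      ≡⟨ stepSum-rot north w closed (λ _ x → 𝟙 (x ℤ.<? 0ℤ)) ⟩
    stepSum (λ _ x → 𝟙 (x - + b ℤ.<? 0ℤ)) 0ℤ (north ∷ w)
      ≡⟨ stepSum-cong pointwise 0ℤ (north ∷ w) ⟩
    stepSum (λ s x → 𝟙 (x ℤ.<? 0ℤ) ℤ.+ onEast P⁻ s x ℤ.+ (g (x ℤ.+ wt s) - g x)) 0ℤ (north ∷ w)
      ≡⟨ stepSum-+ (λ s x → 𝟙 (x ℤ.<? 0ℤ) ℤ.+ onEast P⁻ s x) (λ s x → g (x ℤ.+ wt s) - g x) 0ℤ (north ∷ w) ⟩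
    stepSum (λ s x → 𝟙 (x ℤ.<? 0ℤ) ℤ.+ onEast P⁻ s x) 0ℤ (north ∷ w) ℤ.+
    stepSum (λ s x → g (x ℤ.+ wt s) - g x) 0ℤ (north ∷ w)
      ≡⟨ cong₂ ℤ._+_ (stepSum-+ (λ _ x → 𝟙 (x ℤ.<? 0ℤ)) (onEast P⁻) 0ℤ (north ∷ w))
           (trans (stepSum-telescope g 0ℤ (north ∷ w))
             (ℤ.i≡j⇒i-j≡0 {i = g (0ℤ ℤ.+ weight (north ∷ w))} (cong (λ x → g (0ℤ ℤ.+ x)) closed))) ⟩
    below (north ∷ w) ℤ.+ stepSum (onEast P⁻) 0ℤ (north ∷ w) ℤ.+ 0ℤ
      ≡⟨ ℤ.+-identityʳ _ ⟩
    below (north ∷ w) ℤ.+ stepSum (onEast P⁻) 0ℤ (north ∷ w)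
      ≡⟨ cong (λ z → below (north ∷ w) ℤ.+ z) (trans
           (stepSum-cong closed-levels 0ℤ (north ∷ w))
           (sym (easts≡stepSum P⁻ 0ℤ (north ∷ w)))) ⟩
    below (north ∷ w) ℤ.+ easts P⁻ w ∎
    where
    g : ℤ → ℤ
    g x = - 𝟙 (x ℤ.<? + b)

    closed-levels : ∀ s x → onEast P⁻ s x ≡ onEast (λ x → P⁻ (x - (0ℤ ℤ.+ weight (north ∷ w)))) s x
    closed-levels north x = refl
    closed-levels east  x = cong P⁻ (trans (sym (ℤ.+-identityʳ x)) (cong (λ y → x - (0ℤ ℤ.+ y)) (sym closed)))

    pointwise : ∀ s x → 𝟙 (x - + b ℤ.<? 0ℤ) ≡ 𝟙 (x ℤ.<? 0ℤ) ℤ.+ onEast P⁻ s x ℤ.+ (g (x ℤ.+ wt s) - g x)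
    pointwise north x = begin
      𝟙 (x - + b ℤ.<? 0ℤ)
        ≡⟨ 𝟙-<-shift (x - + b) 0ℤ x (+ b) (shift x (+ b)) ⟩
      𝟙 (x ℤ.<? + b)
        ≡⟨ cancel (𝟙 (x ℤ.<? 0ℤ)) (𝟙 (x ℤ.<? + b)) ⟩
      𝟙 (x ℤ.<? 0ℤ) ℤ.+ 0ℤ ℤ.+ (- 𝟙 (x ℤ.<? 0ℤ) - - 𝟙 (x ℤ.<? + b))
        ≡⟨ cong (λ z → 𝟙 (x ℤ.<? 0ℤ) ℤ.+ 0ℤ ℤ.+ (- z - g x))
             (𝟙-<-shift x 0ℤ (x ℤ.+ + b) (+ b) (shift′ x (+ b))) ⟩
      𝟙 (x ℤ.<? 0ℤ) ℤ.+ 0ℤ ℤ.+ (g (x ℤ.+ + b) - g x) ∎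
      where
      shift : ∀ x b → x - (x - b) ≡ b - 0ℤ
      shift = solve-∀
      shift′ : ∀ x b → x ℤ.+ b - x ≡ b - 0ℤ
      shift′ = solve-∀
      cancel : ∀ u v → v ≡ u ℤ.+ 0ℤ ℤ.+ (- u - - v)
      cancel = solve-∀
    pointwise east x = begin
      𝟙 (x - + b ℤ.<? 0ℤ)
        ≡⟨ 𝟙-<-shift (x - + b) 0ℤ x (+ b) (shift x (+ b)) ⟩
      𝟙 (x ℤ.<? + b)
        ≡⟨ cancel (𝟙 (x ℤ.<? 0ℤ)) (𝟙 (x ℤ.<? n)) (𝟙 (x ℤ.<? + b)) ⟩
      𝟙 (x ℤ.<? 0ℤ) ℤ.+ P⁻ x ℤ.+ (- 𝟙 (x ℤ.<? n) - g x)
        ≡⟨ cong (λ z → 𝟙 (x ℤ.<? 0ℤ) ℤ.+ P⁻ x ℤ.+ (- z - g x))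
             (𝟙-<-shift x n (x ℤ.+ - (+ a)) (+ b) (shift′ x (+ a) (+ b))) ⟩
      𝟙 (x ℤ.<? 0ℤ) ℤ.+ P⁻ x ℤ.+ (g (x ℤ.+ - (+ a)) - g x) ∎
      where
      shift : ∀ x b → x - (x - b) ≡ b - 0ℤ
      shift = solve-∀
      shift′ : ∀ x a b → x ℤ.+ - a - x ≡ b - (a ℤ.+ b)
      shift′ = solve-∀
      cancel : ∀ u v w → w ≡ u ℤ.+ (v - u) ℤ.+ (- v - - w)
      cancel = solve-∀

  -- The threshold is now -a. The two counts differ by the points with -a ≤ x < 0. East steps
  -- departing from there are the ones that cross -a downwards; north steps with -n ≤ x < -a are the
  -- ones that cross it upwards. A closed path has equally many of each, so the east steps may be
  -- exchanged for these north steps, giving all north steps with -n ≤ x < 0.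
  below-rot-east : ∀ w → weight (east ∷ w) ≡ 0ℤ →
    below (east ∷ w) ≡ below (w ∷ʳ east) ℤ.+ stepSum (onNorth (P⁺ ∘ -_)) (wt east) w
  below-rot-east w closed = begin
    below (east ∷ w)
      ≡⟨ stepSum-cong pointwise 0ℤ (east ∷ w) ⟩
    stepSum (λ s x → 𝟙 (x - - (+ a) ℤ.<? 0ℤ) ℤ.+ onNorth (P⁺ ∘ -_) s x ℤ.+ (g (x ℤ.+ wt s) - g x)) 0ℤ (east ∷ w)
      ≡⟨ stepSum-+ (λ s x → 𝟙 (x - - (+ a) ℤ.<? 0ℤ) ℤ.+ onNorth (P⁺ ∘ -_) s x) (λ s x → g (x ℤ.+ wt s) - g x) 0ℤ (east ∷ w) ⟩
    stepSum (λ s x → 𝟙 (x - - (+ a) ℤ.<? 0ℤ) ℤ.+ onNorth (P⁺ ∘ -_) s x) 0ℤ (east ∷ w) ℤ.+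
    stepSum (λ s x → g (x ℤ.+ wt s) - g x) 0ℤ (east ∷ w)
      ≡⟨ cong₂ ℤ._+_ (stepSum-+ (λ _ x → 𝟙 (x - - (+ a) ℤ.<? 0ℤ)) (onNorth (P⁺ ∘ -_)) 0ℤ (east ∷ w))
           (trans (stepSum-telescope g 0ℤ (east ∷ w))
             (ℤ.i≡j⇒i-j≡0 {i = g (0ℤ ℤ.+ weight (east ∷ w))} (cong (λ x → g (0ℤ ℤ.+ x)) closed))) ⟩
    stepSum (λ _ x → 𝟙 (x - - (+ a) ℤ.<? 0ℤ)) 0ℤ (east ∷ w) ℤ.+ stepSum (onNorth (P⁺ ∘ -_)) 0ℤ (east ∷ w) ℤ.+ 0ℤ
      ≡⟨ ℤ.+-identityʳ _ ⟩
    stepSum (λ _ x → 𝟙 (x - - (+ a) ℤ.<? 0ℤ)) 0ℤ (east ∷ w) ℤ.+ stepSum (onNorth (P⁺ ∘ -_)) 0ℤ (east ∷ w)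
      ≡⟨ cong₂ ℤ._+_ (sym (stepSum-rot east w closed (λ _ x → 𝟙 (x ℤ.<? 0ℤ))))
           (trans (ℤ.+-identityˡ _) (cong (λ l → stepSum (onNorth (P⁺ ∘ -_)) l w) (ℤ.+-identityˡ (wt east)))) ⟩
    below (w ∷ʳ east) ℤ.+ stepSum (onNorth (P⁺ ∘ -_)) (wt east) w ∎
    where
    g : ℤ → ℤ
    g x = 𝟙 (x ℤ.<? - (+ a))

    shift : ∀ x a → x - (x - - a) ≡ - a - 0ℤ
    shift = solve-∀

    pointwise : ∀ s x →
      𝟙 (x ℤ.<? 0ℤ) ≡ 𝟙 (x - - (+ a) ℤ.<? 0ℤ) ℤ.+ onNorth (P⁺ ∘ -_) s x ℤ.+ (g (x ℤ.+ wt s) - g x)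
    pointwise north x = begin
      𝟙 (x ℤ.<? 0ℤ)
        ≡⟨ cancel (𝟙 (x ℤ.<? 0ℤ)) (𝟙 (x ℤ.<? - n)) (g x) ⟩
      g x ℤ.+ (𝟙 (x ℤ.<? 0ℤ) - 𝟙 (x ℤ.<? - n)) ℤ.+ (𝟙 (x ℤ.<? - n) - g x)
        ≡⟨ cong₂ (λ u v → u ℤ.+ (𝟙 (x ℤ.<? 0ℤ) - 𝟙 (x ℤ.<? - n)) ℤ.+ (v - g x))
             (sym (𝟙-<-shift (x - - (+ a)) 0ℤ x (- (+ a)) (shift x (+ a))))
             (𝟙-<-shift x (- n) (x ℤ.+ + b) (- (+ a)) (shift′ x (+ a) (+ b))) ⟩
      𝟙 (x - - (+ a) ℤ.<? 0ℤ) ℤ.+ (𝟙 (x ℤ.<? 0ℤ) - 𝟙 (x ℤ.<? - n)) ℤ.+ (g (x ℤ.+ + b) - g x)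
        ≡⟨ cong₂ (λ u v → 𝟙 (x - - (+ a) ℤ.<? 0ℤ) ℤ.+ (u - v) ℤ.+ (g (x ℤ.+ + b) - g x))
             (negate 0ℤ) (negate (- n)) ⟩
      𝟙 (x - - (+ a) ℤ.<? 0ℤ) ℤ.+ (𝟙 (0ℤ ℤ.<? - x) - 𝟙 (- - n ℤ.<? - x)) ℤ.+ (g (x ℤ.+ + b) - g x)
        ≡⟨ cong (λ m → 𝟙 (x - - (+ a) ℤ.<? 0ℤ) ℤ.+ (𝟙 (0ℤ ℤ.<? - x) - 𝟙 (m ℤ.<? - x)) ℤ.+ (g (x ℤ.+ + b) - g x))
             (ℤ.neg-involutive n) ⟩
      𝟙 (x - - (+ a) ℤ.<? 0ℤ) ℤ.+ P⁺ (- x) ℤ.+ (g (x ℤ.+ + b) - g x) ∎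
      where
      negate : ∀ y → 𝟙 (x ℤ.<? y) ≡ 𝟙 (- y ℤ.<? - x)
      negate y = sym (𝟙-neg-< y x)

      shift′ : ∀ x a b → x ℤ.+ b - x ≡ - a - - (a ℤ.+ b)
      shift′ = solve-∀
      cancel : ∀ u v w → u ≡ w ℤ.+ (u - v) ℤ.+ (v - w)
      cancel = solve-∀
    pointwise east x = begin
      𝟙 (x ℤ.<? 0ℤ)
        ≡⟨ cancel (𝟙 (x ℤ.<? 0ℤ)) (g x) ⟩
      g x ℤ.+ 0ℤ ℤ.+ (𝟙 (x ℤ.<? 0ℤ) - g x)
        ≡⟨ cong₂ (λ u v → u ℤ.+ 0ℤ ℤ.+ (v - g x))
             (sym (𝟙-<-shift (x - - (+ a)) 0ℤ x (- (+ a)) (shift x (+ a))))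
             (𝟙-<-shift x 0ℤ (x ℤ.+ - (+ a)) (- (+ a)) (shift′ x (+ a))) ⟩
      𝟙 (x - - (+ a) ℤ.<? 0ℤ) ℤ.+ 0ℤ ℤ.+ (g (x ℤ.+ - (+ a)) - g x) ∎
      where
      shift′ : ∀ x a → x ℤ.+ - a - x ≡ - a - 0ℤ
      shift′ = solve-∀
      cancel : ∀ u w → u ≡ w ℤ.+ 0ℤ ℤ.+ (u - w)
      cancel = solve-∀

  pairs-1-∷ʳ-north : ∀ w → pairs (λ _ → 1ℤ) (w ∷ʳ north) ≡ pairs (λ _ → 1ℤ) w ℤ.+ + #E w
  pairs-1-∷ʳ-north w = trans (pairs-∷ʳ-north (λ _ → 1ℤ) w)
    (cong (λ z → pairs (λ _ → 1ℤ) w ℤ.+ z)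
      (trans (easts≡stepSum (λ _ → 1ℤ) 0ℤ w) (stepSum-onEast-1 0ℤ w)))

  base-rot-north : ∀ w → Balanced (north ∷ w) → base P⁻ (w ∷ʳ north) ≡ base P⁻ (north ∷ w)
  base-rot-north w bal@(_ , #E≡b) = begin
    pairs 1′ (w ∷ʳ north) ℤ.+ minLevel 0ℤ (w ∷ʳ north) ℤ.+ pairs P⁻ (w ∷ʳ north) - below (w ∷ʳ north)
      ≡⟨ cong₂ _-_ (cong₂ (λ u v → u ℤ.+ minLevel 0ℤ (w ∷ʳ north) ℤ.+ v)
           (trans (pairs-1-∷ʳ-north w) (cong (λ e → pairs 1′ w ℤ.+ + e) #E≡b)) (pairs-∷ʳ-north P⁻ w))
           (below-rot-north w (balanced-weight (north ∷ w) bal)) ⟩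
    pairs 1′ w ℤ.+ + b ℤ.+ minLevel 0ℤ (w ∷ʳ north) ℤ.+ (pairs P⁻ w ℤ.+ easts P⁻ w) - (below (north ∷ w) ℤ.+ easts P⁻ w)
      ≡⟨ lemma (pairs 1′ w) (+ b) (minLevel 0ℤ (w ∷ʳ north)) (pairs P⁻ w) (easts P⁻ w) (below (north ∷ w)) ⟩
    pairs 1′ w ℤ.+ (minLevel 0ℤ (w ∷ʳ north) ℤ.+ + b) ℤ.+ pairs P⁻ w - below (north ∷ w)
      ≡⟨ cong (λ m → pairs 1′ w ℤ.+ m ℤ.+ pairs P⁻ w - below (north ∷ w))
           (minLevel-rot north w (balanced-weight (north ∷ w) bal)) ⟨
    base P⁻ (north ∷ w) ∎
    where
    1′ : ℤ → ℤ
    1′ _ = 1ℤ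

    lemma : ∀ p b m h e r → p ℤ.+ b ℤ.+ m ℤ.+ (h ℤ.+ e) - (r ℤ.+ e) ≡ p ℤ.+ (m ℤ.+ b) ℤ.+ h - r
    lemma = solve-∀

  base-rot-east : ∀ w → Balanced (east ∷ w) → base P⁺ (w ∷ʳ east) ≡ base P⁺ (east ∷ w)
  base-rot-east w bal@(#N≡a , _) = begin
    pairs 1′ (w ∷ʳ east) ℤ.+ minLevel 0ℤ (w ∷ʳ east) ℤ.+ pairs P⁺ (w ∷ʳ east) - below (w ∷ʳ east)
      ≡⟨ cong₂ (λ u v → u ℤ.+ minLevel 0ℤ (w ∷ʳ east) ℤ.+ v - below (w ∷ʳ east))
           (pairs-∷ʳ-east 1′ w) (pairs-∷ʳ-east P⁺ w) ⟩
    pairs 1′ w ℤ.+ minLevel 0ℤ (w ∷ʳ east) ℤ.+ pairs P⁺ w - below (w ∷ʳ east)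
      ≡⟨ lemma (pairs 1′ w) (+ a) (minLevel 0ℤ (w ∷ʳ east)) (pairs P⁺ w)
           (stepSum (onNorth (P⁺ ∘ -_)) (wt east) w) (below (w ∷ʳ east)) ⟩
    pairs 1′ w ℤ.+ + a ℤ.+ (minLevel 0ℤ (w ∷ʳ east) ℤ.+ - (+ a)) ℤ.+ pairs P⁺ (east ∷ w) -
    (below (w ∷ʳ east) ℤ.+ stepSum (onNorth (P⁺ ∘ -_)) (wt east) w)
      ≡⟨ cong₂ _-_ (cong₂ (λ u v → u ℤ.+ v ℤ.+ pairs P⁺ (east ∷ w))
           (cong (λ z → pairs 1′ w ℤ.+ z) (trans (stepSum-onNorth-1 (wt east) w) (cong +_ #N≡a)))
           (minLevel-rot east w (balanced-weight (east ∷ w) bal)))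
           (below-rot-east w (balanced-weight (east ∷ w) bal)) ⟨
    base P⁺ (east ∷ w) ∎
    where
    1′ : ℤ → ℤ
    1′ _ = 1ℤ

    lemma : ∀ p a m h e r → p ℤ.+ m ℤ.+ h - r ≡ p ℤ.+ a ℤ.+ (m ℤ.+ - a) ℤ.+ (h ℤ.+ e) - (r ℤ.+ e)
    lemma = solve-∀

  -- Sums over successive rotations

  balanced-length : ∀ w → Balanced w → length w ≡ a + b
  balanced-length w (#N≡a , #E≡b) = trans (sym (length-#N+#E w)) (cong₂ _+_ #N≡a #E≡b)

  rot-balanced : ∀ w → Balanced w → Balanced (rot w)
  rot-balanced w (#N≡a , #E≡b) = trans (#N-rot w) #N≡a ,
    trans (ℕ.+-cancelˡ-≡ (#N w) (#E (rot w)) (#E w) (begin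
      #N w + #E (rot w)       ≡⟨ cong (_+ #E (rot w)) (#N-rot w) ⟨
      #N (rot w) + #E (rot w) ≡⟨ length-#N+#E (rot w) ⟩
      length (rot w)          ≡⟨ length-rot w ⟩
      length w                ≡⟨ length-#N+#E w ⟨
      #N w + #E w ∎)) #E≡b
    where
    length-rot : ∀ w → length (rot w) ≡ length w
    length-rot []      = refl
    length-rot (s ∷ w) = trans (List.length-++ w) (ℕ.+-comm (length w) 1)

  orbitSum : ℕ → (Word → ℤ) → Word → ℤ
  orbitSum zero    f w = 0ℤ
  orbitSum (suc k) f w = f w ℤ.+ orbitSum k f (rot w)

  -- Each of the k summands is `f` after some number of rotations, and rotation permutes the
  -- balanced words.
  sum-orbitSum : ∀ k f → sum (balanced a b) (orbitSum k f) ≡ + k ℤ.* sum (balanced a b) f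
  sum-orbitSum zero    f = sum-0 (balanced a b)
  sum-orbitSum (suc k) f = begin
    sum (balanced a b) (λ w → f w ℤ.+ orbitSum k f (rot w))
      ≡⟨ sum-+ (balanced a b) f (orbitSum k f ∘ rot) ⟩
    S ℤ.+ sum (balanced a b) (orbitSum k f ∘ rot)
      ≡⟨ cong (λ z → S ℤ.+ z) (trans (sum-balanced-rot a b (orbitSum k f)) (sum-orbitSum k f)) ⟩
    S ℤ.+ + k ℤ.* S
      ≡⟨ lemma S (+ k) ⟩
    + suc k ℤ.* S ∎
    where
    S = sum (balanced a b) f

    lemma : ∀ s k → s ℤ.+ k ℤ.* s ≡ (1ℤ ℤ.+ k) ℤ.* s
    lemma = solve-∀

  -- The rotated path starts at the point of level `weight u`, which is subtracted from all levels.
  -- Negative afterwards are exactly the points that were lower than this start.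
  below-rotation : ∀ u v → weight (u ++ v) ≡ 0ℤ → below (v ++ u) ≡ rank (levels 0ℤ (u ++ v)) (weight u)
  below-rotation u v closed = begin
    below (v ++ u)
      ≡⟨ stepSum-++ (λ _ x → 𝟙 (x ℤ.<? 0ℤ)) 0ℤ v u ⟩
    stepSum (λ _ x → 𝟙 (x ℤ.<? 0ℤ)) 0ℤ v ℤ.+ stepSum (λ _ x → 𝟙 (x ℤ.<? 0ℤ)) (0ℤ ℤ.+ weight v) u
      ≡⟨ cong₂ ℤ._+_ (move 0ℤ v) (move (0ℤ ℤ.+ weight v) u) ⟩
    stepSum φ (0ℤ ℤ.+ weight u) v ℤ.+ stepSum φ (0ℤ ℤ.+ weight v ℤ.+ weight u) u
      ≡⟨ ℤ.+-comm (stepSum φ (0ℤ ℤ.+ weight u) v) _ ⟩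
    stepSum φ (0ℤ ℤ.+ weight v ℤ.+ weight u) u ℤ.+ stepSum φ (0ℤ ℤ.+ weight u) v
      ≡⟨ cong (λ l → stepSum φ l u ℤ.+ stepSum φ (0ℤ ℤ.+ weight u) v)
           (trans (lemma (weight u) (weight v)) (trans (sym (weight-++ u v)) closed)) ⟩
    stepSum φ 0ℤ u ℤ.+ stepSum φ (0ℤ ℤ.+ weight u) v
      ≡⟨ stepSum-++ φ 0ℤ u v ⟨
    stepSum φ 0ℤ (u ++ v)
      ≡⟨ stepSum-levels (λ x → 𝟙 (x ℤ.<? weight u)) 0ℤ (u ++ v) ⟩
    rank (levels 0ℤ (u ++ v)) (weight u) ∎
    where
    φ : Step → ℤ → ℤ
    φ _ x = 𝟙 (x ℤ.<? weight u)

    lemma : ∀ x y → 0ℤ ℤ.+ y ℤ.+ x ≡ x ℤ.+ y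
    lemma = solve-∀

    shift : ∀ x y → x ℤ.+ y - x ≡ y - 0ℤ
    shift = solve-∀

    move : ∀ l w → stepSum (λ _ x → 𝟙 (x ℤ.<? 0ℤ)) l w ≡ stepSum φ (l ℤ.+ weight u) w
    move l w = trans
      (stepSum-cong (λ _ x → 𝟙-<-shift x 0ℤ (x ℤ.+ weight u) (weight u) (shift x (weight u))) l w)
      (sym (stepSum-shift φ (weight u) l w))

  -- `u` collects the steps already moved to the end, so that `u ++ v` stays fixed through the
  -- induction and `levels (weight u) v` lists the starting points still to come.
  orbitSum-below : ∀ (φ : ℤ → ℤ) u v → weight (u ++ v) ≡ 0ℤ →
    orbitSum (length v) (φ ∘ below) (v ++ u) ≡ sum (levels (weight u) v) (φ ∘ rank (levels 0ℤ (u ++ v)))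
  orbitSum-below φ u []      closed = refl
  orbitSum-below φ u (s ∷ v) closed = cong₂ ℤ._+_ (cong φ (below-rotation u (s ∷ v) closed)) (begin
    orbitSum (length v) (φ ∘ below) ((v ++ u) ∷ʳ s)
      ≡⟨ cong (orbitSum (length v) (φ ∘ below)) (List.++-assoc v u (s ∷ [])) ⟩
    orbitSum (length v) (φ ∘ below) (v ++ u ∷ʳ s)
      ≡⟨ orbitSum-below φ (u ∷ʳ s) v (trans (cong weight (List.++-assoc u (s ∷ []) v)) closed) ⟩
    sum (levels (weight (u ∷ʳ s)) v) (φ ∘ rank (levels 0ℤ (u ∷ʳ s ++ v)))
      ≡⟨ cong₂ (λ l w → sum (levels l v) (φ ∘ rank (levels 0ℤ w))) (weight-∷ʳ u s) (List.++-assoc u (s ∷ []) v) ⟩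
    sum (levels (weight u ℤ.+ wt s) v) (φ ∘ rank (levels 0ℤ (u ++ s ∷ v))) ∎)

-- Consequences of coprimality

module _ (a b : ℕ) (coprime : Coprime a b) where

  -- Modulo n = a + b one has -a ≡ b, so the level is congruent to b (f + e). As n is coprime to b,
  -- it would have to divide e + f, which lies strictly between 0 and n.
  ¬n∣level : ∀ e f → 0 ℕ.< e + f → e + f ℕ.< a + b → ¬ (n a b ∣ + b ℤ.* + f - + a ℤ.* + e)
  ¬n∣level e f 0<e+f e+f<n n∣x = ℕ.>⇒∤ {{ℕ.>-nonZero 0<e+f}} e+f<n (subst (a + b ℕ.∣_) (ℕ.+-comm f e)
    (ℤ.coprime-divisor (n a b) (+ b) (+ f ℤ.+ + e)
      (subst (λ k → Coprime k b) (ℕ.+-comm b a) (coprime-+ coprime))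
      (∣⇒∣ᵤ (subst (n a b ∣_) (lemma (+ a) (+ b) (+ e) (+ f)) (∣m∣n⇒∣m+n n∣x (∣m⇒∣m*n (+ e) ∣-refl))))))
    where
    lemma : ∀ a b e f → b ℤ.* f - a ℤ.* e ℤ.+ (a ℤ.+ b) ℤ.* e ≡ b ℤ.* (f ℤ.+ e)
    lemma = solve-∀

  -- `e` and `f` count the steps taken since the reference level `x`. The length bound keeps every
  -- departure point of `w` fewer than a + b steps away from it.
  ¬n∣levels : ∀ w e f {x l} → l ≡ x ℤ.+ (+ b ℤ.* + f - + a ℤ.* + e) →
    0 ℕ.< e + f → e + f + length w ℕ.≤ a + b → All (λ y → ¬ (n a b ∣ y - x)) (levels a b l w)
  ¬n∣levels []      e f         _    _     _  = []
  ¬n∣levels (s ∷ w) e f {x} {l} refl 0<e+f le =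
    (λ n∣ → ¬n∣level e f 0<e+f (ℕ.≤-trans (ℕ.s≤s (ℕ.m≤m+n (e + f) (length w))) le′)
      (subst (n a b ∣_) (cancel x (+ b ℤ.* + f - + a ℤ.* + e)) n∣))
    ∷ tail s
    where
    le′ : suc (e + f) + length w ℕ.≤ a + b
    le′ = ℕ.≤-trans (ℕ.≤-reflexive (sym (ℕ.+-suc (e + f) (length w)))) le

    cancel : ∀ x y → x ℤ.+ y - x ≡ y
    cancel = solve-∀

    tail : ∀ s → All (λ y → ¬ (n a b ∣ y - x)) (levels a b (l ℤ.+ wt a b s) w)
    tail north = ¬n∣levels w e (suc f) (lemma x (+ a) (+ b) (+ e) (+ f))
      (ℕ.≤-trans 0<e+f (ℕ.+-monoʳ-≤ e (ℕ.n≤1+n f)))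
      (subst (λ i → i + length w ℕ.≤ a + b) (sym (ℕ.+-suc e f)) le′)
      where
      lemma : ∀ x a b e f → x ℤ.+ (b ℤ.* f - a ℤ.* e) ℤ.+ b ≡ x ℤ.+ (b ℤ.* (1ℤ ℤ.+ f) - a ℤ.* e)
      lemma = solve-∀
    tail east = ¬n∣levels w (suc e) f (lemma x (+ a) (+ b) (+ e) (+ f)) (ℕ.s≤s ℕ.z≤n) le′
      where
      lemma : ∀ x a b e f → x ℤ.+ (b ℤ.* f - a ℤ.* e) ℤ.+ - a ≡ x ℤ.+ (b ℤ.* f - a ℤ.* (1ℤ ℤ.+ e))
      lemma = solve-∀

  levels-unique : ∀ l w → length w ℕ.≤ a + b → Unique (levels a b l w)
  levels-unique l []      _  = []
  levels-unique l (s ∷ w) le =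
    All.map (λ ¬n∣ l≡y → ¬n∣ (divides 0ℤ (ℤ.i≡j⇒i-j≡0 (sym l≡y)))) (later s) ∷
    levels-unique (l ℤ.+ wt a b s) w (ℕ.<⇒≤ le)
    where
    later : ∀ s → All (λ y → ¬ (n a b ∣ y - l)) (levels a b (l ℤ.+ wt a b s) w)
    later north = ¬n∣levels w 0 1 (cong (λ z → l ℤ.+ z) (lemma (+ a) (+ b))) (ℕ.s≤s ℕ.z≤n) le
      where
      lemma : ∀ a b → b ≡ b ℤ.* 1ℤ - a ℤ.* 0ℤ
      lemma = solve-∀
    later east = ¬n∣levels w 1 0 (cong (λ z → l ℤ.+ z) (lemma (+ a) (+ b))) (ℕ.s≤s ℕ.z≤n) le
      where
      lemma : ∀ a b → - a ≡ b ℤ.* 0ℤ - a ℤ.* 1ℤ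
      lemma = solve-∀

  -- The two can differ only at d = 0 and d = n, both multiples of n.
  P⁺≡P⁻ : ∀ {d} → ¬ (n a b ∣ d) → P⁺ a b d ≡ P⁻ a b d
  P⁺≡P⁻ {d} ¬n∣d = begin
    𝟙 (0ℤ ℤ.<? d) - 𝟙 (n a b ℤ.<? d)
      ≡⟨ cong₂ _-_ (𝟙-<-flip {0ℤ} {d} λ { refl → ¬n∣d (divides 0ℤ refl) })
                   (𝟙-<-flip {n a b} {d} λ { refl → ¬n∣d ∣-refl }) ⟩
    1ℤ - 𝟙 (d ℤ.<? 0ℤ) - (1ℤ - 𝟙 (d ℤ.<? n a b))
      ≡⟨ lemma (𝟙 (d ℤ.<? 0ℤ)) (𝟙 (d ℤ.<? n a b)) ⟩
    P⁻ a b d ∎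
    where
    lemma : ∀ u v → 1ℤ - u - (1ℤ - v) ≡ v - u
    lemma = solve-∀

  pairs⁺≡pairs⁻ : ∀ w → length w ℕ.≤ a + b → pairs a b (P⁺ a b) w ≡ pairs a b (P⁻ a b) w
  pairs⁺≡pairs⁻ []          _  = refl
  pairs⁺≡pairs⁻ (north ∷ w) le = pairs⁺≡pairs⁻ w (ℕ.<⇒≤ le)
  pairs⁺≡pairs⁻ (east ∷ w)  le = cong₂ ℤ._+_ (pairs⁺≡pairs⁻ w (ℕ.<⇒≤ le))
    (stepSum-cong-levels a b pointwise (wt a b east) w
      (¬n∣levels w 1 0 {0ℤ} (lemma (+ a) (+ b)) (ℕ.s≤s ℕ.z≤n) le))
    where
    lemma : ∀ a b → - a ≡ 0ℤ ℤ.+ (b ℤ.* 0ℤ - a ℤ.* 1ℤ)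
    lemma = solve-∀

    pointwise : ∀ s x → ¬ (n a b ∣ x - 0ℤ) →
      onNorth a b (P⁺ a b ∘ -_) s x ≡ onNorth a b (P⁻ a b ∘ -_) s x
    pointwise north x ¬n∣x = P⁺≡P⁻ λ n∣-x → ¬n∣x
      (subst (n a b ∣_) (trans (ℤ.neg-involutive x) (sym (ℤ.+-identityʳ x))) (∣m⇒∣-m n∣-x))
    pointwise east  x _ = refl

  stat⁺≡stat⁻ : ∀ w → Balanced a b w → stat a b (P⁺ a b) w ≡ stat a b (P⁻ a b) w
  stat⁺≡stat⁻ w bal = cong (λ z → pairs a b (λ _ → 1ℤ) w ℤ.+ minLevel a b 0ℤ w ℤ.+ z)
    (pairs⁺≡pairs⁻ w (ℕ.≤-reflexive (balanced-length a b w bal)))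

  -- Each kind of rotation is exact for its own `P`, so the north case passes to `P⁻` and back.
  base-rot : ∀ w → Balanced a b w → base a b (P⁺ a b) (rot w) ≡ base a b (P⁺ a b) w
  base-rot []          bal = refl
  base-rot (north ∷ w) bal = begin
    base a b (P⁺ a b) (w ∷ʳ north)
      ≡⟨ cong (_- below a b (w ∷ʳ north)) (stat⁺≡stat⁻ (w ∷ʳ north) (rot-balanced a b (north ∷ w) bal)) ⟩
    base a b (P⁻ a b) (w ∷ʳ north)
      ≡⟨ base-rot-north a b w bal ⟩
    base a b (P⁻ a b) (north ∷ w)
      ≡⟨ cong (_- below a b (north ∷ w)) (stat⁺≡stat⁻ (north ∷ w) bal) ⟨
    base a b (P⁺ a b) (north ∷ w) ∎
  base-rot (east ∷ w)  bal = base-rot-east a b w bal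

  -- Two separate arguments of `ψ` allow the invariant one to be frozen at `w` while the other still
  -- varies over the rotations.
  orbitSum-base : ∀ (ψ : ℤ → ℤ → ℤ) k w → Balanced a b w →
    orbitSum a b k (λ v → ψ (below a b v) (base a b (P⁺ a b) v)) w ≡
    orbitSum a b k (λ v → ψ (below a b v) (base a b (P⁺ a b) w)) w
  orbitSum-base ψ zero    w bal = refl
  orbitSum-base ψ (suc k) w bal = cong (λ z → ψ (below a b w) (base a b (P⁺ a b) w) ℤ.+ z) (trans
    (orbitSum-base ψ k (rot w) (rot-balanced a b w bal))
    (cong (λ g → orbitSum a b k (λ v → ψ (below a b v) g) (rot w)) (base-rot w bal)))

  -- By distinctness of levels, below takes each value 0, …, a + b - 1 once on the rotations of a word.
  orbitSum-upTo : ∀ (ψ : ℤ → ℤ → ℤ) w → Balanced a b w →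
    orbitSum a b (a + b) (λ v → ψ (below a b v) (base a b (P⁺ a b) v)) w ≡
    sum (upTo (a + b)) (λ j → ψ (+ j) (base a b (P⁺ a b) w))
  orbitSum-upTo ψ w bal = begin
    orbitSum a b (a + b) (λ v → ψ (below a b v) (base a b (P⁺ a b) v)) w
      ≡⟨ orbitSum-base ψ (a + b) w bal ⟩
    orbitSum a b (a + b) (φ ∘ below a b) w
      ≡⟨ cong₂ (λ k v → orbitSum a b k (φ ∘ below a b) v) (sym |w|) (sym (List.++-identityʳ w)) ⟩
    orbitSum a b (length w) (φ ∘ below a b) (w ++ [])
      ≡⟨ orbitSum-below a b φ [] w (balanced-weight a b w bal) ⟩
    sum (levels a b 0ℤ w) (φ ∘ rank (levels a b 0ℤ w))
      ≡⟨ sum-rank (levels a b 0ℤ w) (levels-unique 0ℤ w (ℕ.≤-reflexive |w|)) φ ⟩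
    sum (upTo (length (levels a b 0ℤ w))) (φ ∘ +_)
      ≡⟨ cong (λ k → sum (upTo k) (φ ∘ +_)) (trans (length-levels a b 0ℤ w) |w|) ⟩
    sum (upTo (a + b)) (φ ∘ +_) ∎
    where
    φ : ℤ → ℤ
    φ r = ψ r (base a b (P⁺ a b) w)

    |w| : length w ≡ a + b
    |w| = balanced-length a b w bal

  -- The averaging principle, general in `ψ` because it is applied twice: to the monomial with
  -- exponent `base` + `below` for all partitions, and to the monomial with exponent `base`,
  -- restricted to `below` = 0, for those in the triangle.
  sum-below-base : ∀ (ψ : ℤ → ℤ → ℤ) →
    n a b ℤ.* sum (balanced a b) (λ w → ψ (below a b w) (base a b (P⁺ a b) w)) ≡
    sum (balanced a b) (λ w → sum (upTo (a + b)) λ j → ψ (+ j) (base a b (P⁺ a b) w))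
  sum-below-base ψ = trans
    (sym (sum-orbitSum a b (a + b) λ w → ψ (below a b w) (base a b (P⁺ a b) w)))
    (sum-cong-∈ (balanced a b) λ w∈ → orbitSum-upTo ψ _ (balanced-counts w∈))

-- Statistics of partitions

sum-cells-∷ : ∀ m (μ : Vec ℕ k) (f : Cell (suc k) → ℤ) →
  sum (cells (m ∷ μ)) f ≡ sum (upTo m) (λ x → f (zero , x)) ℤ.+ sum (cells μ) (λ (i , x) → f (suc i , x))
sum-cells-∷ {k} m μ f = begin
  sum (cells (m ∷ μ)) f
    ≡⟨ sum-rows (m ∷ μ) f ⟩
  rowSum zero ℤ.+ sum (tabulate suc) rowSum
    ≡⟨ cong (λ z → rowSum zero ℤ.+ z) (trans (cong (λ is → sum is rowSum) (sym (List.map-tabulate {n = k} (λ i → i) suc)))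
         (sum-map suc (allFin k) rowSum)) ⟩
  rowSum zero ℤ.+ sum (allFin k) (rowSum ∘ suc)
    ≡⟨ cong (λ z → rowSum zero ℤ.+ z) (sum-rows μ λ (i , x) → f (suc i , x)) ⟨
  rowSum zero ℤ.+ sum (cells μ) (λ (i , x) → f (suc i , x)) ∎
  where
  sum-rows : ∀ {k} (μ : Vec ℕ k) (f : Cell k → ℤ) →
    sum (cells μ) f ≡ sum (allFin k) λ i → sum (upTo (lookup μ i)) λ x → f (i , x)
  sum-rows {k} μ f = trans (sum-concatMap (λ i → map (i ,_) (upTo (lookup μ i))) (allFin k) f)
    (sum-cong (allFin k) λ i → sum-map (i ,_) (upTo (lookup μ i)) f)

  rowSum : Fin (suc k) → ℤ
  rowSum i = sum (upTo (lookup (m ∷ μ) i)) λ x → f (i , x)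

sum-upTo-> : ∀ m x → sum (upTo m) (λ y → 𝟙 (x ℕ.<? y)) ≡ + (m ℕ.∸ suc x)
sum-upTo-> zero    x       = refl
sum-upTo-> (suc m) zero    = begin
  sum (upTo (suc m)) (λ y → 𝟙 (0 ℕ.<? y))           ≡⟨ sum-upTo-first m (λ y → 𝟙 (0 ℕ.<? y)) ⟩
  0ℤ ℤ.+ sum (upTo m) (λ y → 𝟙 (0 ℕ.<? suc y))      ≡⟨ ℤ.+-identityˡ _ ⟩
  sum (upTo m) (λ y → 𝟙 (0 ℕ.<? suc y))             ≡⟨ sum-cong (upTo m) (λ y → 𝟙-yes (0 ℕ.<? suc y) (ℕ.s≤s ℕ.z≤n)) ⟩
  sum (upTo m) (λ _ → 1ℤ)                           ≡⟨ sum-upTo-1 m ⟩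
  + m ∎
sum-upTo-> (suc m) (suc x) = begin
  sum (upTo (suc m)) (λ y → 𝟙 (suc x ℕ.<? y))       ≡⟨ sum-upTo-first m (λ y → 𝟙 (suc x ℕ.<? y)) ⟩
  0ℤ ℤ.+ sum (upTo m) (λ y → 𝟙 (suc x ℕ.<? suc y))  ≡⟨ ℤ.+-identityˡ _ ⟩
  sum (upTo m) (λ y → 𝟙 (suc x ℕ.<? suc y))         ≡⟨ sum-cong (upTo m) (λ y → 𝟙-cong (suc x ℕ.<? suc y) (x ℕ.<? y) ℕ.≤-pred ℕ.s≤s) ⟩
  sum (upTo m) (λ y → 𝟙 (x ℕ.<? y))                 ≡⟨ sum-upTo-> m x ⟩
  + (m ℕ.∸ suc x) ∎

sum-upTo-≟ : ∀ m x → sum (upTo m) (λ y → 𝟙 (y ℕ.≟ x)) ≡ 𝟙 (x ℕ.<? m)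
sum-upTo-≟ m x = go (x ℕ.<? m)
  where
  go : Dec (x ℕ.< m) → sum (upTo m) (λ y → 𝟙 (y ℕ.≟ x)) ≡ 𝟙 (x ℕ.<? m)
  go (yes x<m) = begin
    sum (upTo m) (λ y → 𝟙 (y ℕ.≟ x))          ≡⟨ sum-cong (upTo m) (λ y → sym (ℤ.*-identityʳ (𝟙 (y ℕ.≟ x)))) ⟩
    sum (upTo m) (λ y → 𝟙 (y ℕ.≟ x) ℤ.* 1ℤ)   ≡⟨ sum-upTo-𝟙≟ x (λ _ → 1ℤ) x<m ⟩
    1ℤ                                        ≡⟨ 𝟙-yes (x ℕ.<? m) x<m ⟨
    𝟙 (x ℕ.<? m) ∎
  go (no x≮m) = begin
    sum (upTo m) (λ y → 𝟙 (y ℕ.≟ x))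
      ≡⟨ sum-cong-∈ (upTo m) (λ {y} y∈ → 𝟙-no (y ℕ.≟ x) λ { refl → x≮m (∈-upTo⁻ y∈) }) ⟩
    sum (upTo m) (λ _ → 0ℤ) ≡⟨ sum-0 (upTo m) ⟩
    0ℤ                      ≡⟨ 𝟙-no (x ℕ.<? m) x≮m ⟨
    𝟙 (x ℕ.<? m) ∎

column : Vec ℕ k → ℕ → ℤ
column []      x = 0ℤ
column (m ∷ μ) x = 𝟙 (x ℕ.<? m) ℤ.+ column μ x

column-outside : ∀ {m} {μ : Vec ℕ k} → VecAll.All (ℕ._≤ m) μ → column μ m ≡ 0ℤ
column-outside []            = refl
column-outside {m = m} (_∷_ {x = x} x≤m μ≤m) = cong₂ ℤ._+_ (𝟙-no (m ℕ.<? x) (ℕ.≤⇒≯ x≤m)) (column-outside μ≤m)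

sum-cells-column : ∀ (μ : Vec ℕ k) x → sum (cells μ) (λ c → 𝟙 (col c ℕ.≟ x)) ≡ column μ x
sum-cells-column []      x = refl
sum-cells-column (m ∷ μ) x = trans (sum-cells-∷ m μ λ c → 𝟙 (col c ℕ.≟ x))
  (cong₂ ℤ._+_ (sum-upTo-≟ m x) (sum-cells-column μ x))

armCount legCount : Cell k → Cell k → ℤ
armCount c c′ = 𝟙 (row c′ Fin.≟ row c ×-dec col c ℕ.<? col c′)
legCount c c′ = 𝟙 (col c′ ℕ.≟ col c ×-dec row c Fin.<? row c′)

arm≡sum : ∀ (μ : Vec ℕ k) c → + arm μ c ≡ sum (cells μ) (armCount c)
arm≡sum μ c = length-filter (λ c′ → row c′ Fin.≟ row c ×-dec col c ℕ.<? col c′) (cells μ)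

leg≡sum : ∀ (μ : Vec ℕ k) c → + leg μ c ≡ sum (cells μ) (legCount c)
leg≡sum μ c = length-filter (λ c′ → col c′ ℕ.≟ col c ×-dec row c Fin.<? row c′) (cells μ)

arm-zero : ∀ m (μ : Vec ℕ k) x → + arm (m ∷ μ) (zero , x) ≡ + (m ℕ.∸ suc x)
arm-zero {k} m μ x = begin
  + arm (m ∷ μ) (zero , x)
    ≡⟨ trans (arm≡sum (m ∷ μ) (zero , x)) (sum-cells-∷ m μ (armCount (zero , x))) ⟩
  sum (upTo m) (λ y → armCount {suc k} (zero , x) (zero , y)) ℤ.+
  sum (cells μ) (λ (i , y) → armCount (zero , x) (suc i , y))
    ≡⟨ cong₂ ℤ._+_
         (sum-cong (upTo m) λ y → 𝟙-cong (Fin.zero {k} Fin.≟ zero ×-dec x ℕ.<? y) (x ℕ.<? y) proj₂ (refl ,_))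
         (sum-cong (cells μ) λ (i , y) → 𝟙-no (suc i Fin.≟ zero ×-dec x ℕ.<? y) λ ()) ⟩
  sum (upTo m) (λ y → 𝟙 (x ℕ.<? y)) ℤ.+ sum (cells μ) (λ _ → 0ℤ)
    ≡⟨ cong₂ ℤ._+_ (sum-upTo-> m x) (sum-0 (cells μ)) ⟩
  + (m ℕ.∸ suc x) ℤ.+ 0ℤ
    ≡⟨ ℤ.+-identityʳ _ ⟩
  + (m ℕ.∸ suc x) ∎

arm-suc : ∀ m (μ : Vec ℕ k) i x → + arm (m ∷ μ) (suc i , x) ≡ + arm μ (i , x)
arm-suc m μ i x = begin
  + arm (m ∷ μ) (suc i , x)
    ≡⟨ trans (arm≡sum (m ∷ μ) (suc i , x)) (sum-cells-∷ m μ (armCount (suc i , x))) ⟩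
  sum (upTo m) (λ y → armCount (suc i , x) (zero , y)) ℤ.+
  sum (cells μ) (λ (j , y) → armCount (suc i , x) (suc j , y))
    ≡⟨ cong₂ ℤ._+_
         (sum-cong (upTo m) λ y → 𝟙-no (zero Fin.≟ suc i ×-dec x ℕ.<? y) λ ())
         (sum-cong (cells μ) λ (j , y) → 𝟙-cong (suc j Fin.≟ suc i ×-dec x ℕ.<? y) (j Fin.≟ i ×-dec x ℕ.<? y)
            (λ (j≡i , x<y) → Fin.suc-injective j≡i , x<y) (λ (j≡i , x<y) → cong suc j≡i , x<y)) ⟩
  sum (upTo m) (λ _ → 0ℤ) ℤ.+ sum (cells μ) (armCount (i , x))
    ≡⟨ cong₂ ℤ._+_ (sum-0 (upTo m)) (sym (arm≡sum μ (i , x))) ⟩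
  + arm μ (i , x) ∎

leg-zero : ∀ m (μ : Vec ℕ k) x → + leg (m ∷ μ) (zero , x) ≡ column μ x
leg-zero {k} m μ x = begin
  + leg (m ∷ μ) (zero , x)
    ≡⟨ trans (leg≡sum (m ∷ μ) (zero , x)) (sum-cells-∷ m μ (legCount (zero , x))) ⟩
  sum (upTo m) (λ y → legCount {suc k} (zero , x) (zero , y)) ℤ.+
  sum (cells μ) (λ (j , y) → legCount (zero , x) (suc j , y))
    ≡⟨ cong₂ ℤ._+_
         (sum-cong (upTo m) λ y → 𝟙-no (y ℕ.≟ x ×-dec Fin.zero {k} Fin.<? Fin.zero {k}) λ ())
         (sum-cong (cells μ) λ (j , y) → 𝟙-cong (y ℕ.≟ x ×-dec Fin.zero {k} Fin.<? suc j) (y ℕ.≟ x)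
            proj₁ (_, ℕ.s≤s ℕ.z≤n)) ⟩
  sum (upTo m) (λ _ → 0ℤ) ℤ.+ sum (cells μ) (λ c → 𝟙 (col c ℕ.≟ x))
    ≡⟨ cong₂ ℤ._+_ (sum-0 (upTo m)) (sum-cells-column μ x) ⟩
  0ℤ ℤ.+ column μ x
    ≡⟨ ℤ.+-identityˡ _ ⟩
  column μ x ∎

leg-suc : ∀ m (μ : Vec ℕ k) i x → + leg (m ∷ μ) (suc i , x) ≡ + leg μ (i , x)
leg-suc {k} m μ i x = begin
  + leg (m ∷ μ) (suc i , x)
    ≡⟨ trans (leg≡sum (m ∷ μ) (suc i , x)) (sum-cells-∷ m μ (legCount (suc i , x))) ⟩
  sum (upTo m) (λ y → legCount (suc i , x) (zero , y)) ℤ.+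
  sum (cells μ) (λ (j , y) → legCount (suc i , x) (suc j , y))
    ≡⟨ cong₂ ℤ._+_
         (sum-cong (upTo m) λ y → 𝟙-no (y ℕ.≟ x ×-dec suc i Fin.<? Fin.zero {k}) λ ())
         (sum-cong (cells μ) λ (j , y) → 𝟙-cong (y ℕ.≟ x ×-dec suc i Fin.<? suc j) (y ℕ.≟ x ×-dec i Fin.<? j)
            (λ (y≡x , i<j) → y≡x , ℕ.≤-pred i<j) (λ (y≡x , i<j) → y≡x , ℕ.s≤s i<j)) ⟩
  sum (upTo m) (λ _ → 0ℤ) ℤ.+ sum (cells μ) (legCount (i , x))
    ≡⟨ cong₂ ℤ._+_ (sum-0 (upTo m)) (sym (leg≡sum μ (i , x))) ⟩
  + leg μ (i , x) ∎

-- The explicit arm and leg of each cell of the top row, then the rows below. This recursion mirrors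
-- that of `pairs` when a north step is appended.
cellSum : (ℤ → ℤ → ℤ) → Vec ℕ k → ℤ
cellSum ψ []      = 0ℤ
cellSum ψ (m ∷ μ) = sum (upTo m) (λ x → ψ (+ (m ℕ.∸ suc x)) (column μ x)) ℤ.+ cellSum ψ μ

cellSum-1 : ∀ (μ : Vec ℕ k) → cellSum (λ _ _ → 1ℤ) μ ≡ + size μ
cellSum-1 []      = refl
cellSum-1 (m ∷ μ) = cong₂ ℤ._+_ (sum-upTo-1 m) (cellSum-1 μ)

sum-cells-arm-leg : ∀ (ψ : ℤ → ℤ → ℤ) (μ : Vec ℕ k) →
  sum (cells μ) (λ c → ψ (+ arm μ c) (+ leg μ c)) ≡ cellSum ψ μ
sum-cells-arm-leg ψ []      = refl
sum-cells-arm-leg ψ (m ∷ μ) = trans (sum-cells-∷ m μ λ c → ψ (+ arm (m ∷ μ) c) (+ leg (m ∷ μ) c))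
  (cong₂ ℤ._+_
    (sum-cong (upTo m) λ x → cong₂ ψ (arm-zero m μ x) (leg-zero m μ x))
    (trans (sum-cong (cells μ) λ (i , x) → cong₂ ψ (arm-suc m μ i x) (leg-suc m μ i x))
           (sum-cells-arm-leg ψ μ)))

-- From partitions to words

module _ (a b : ℕ) where

  -- The drop in level from the start of the east step below a cell to the start of the north step to its right.
  drop : ℤ → ℤ → ℤ
  drop x y = + a ℤ.* x - + b ℤ.* y ℤ.+ + a

  -a≤b : - (+ a) ℤ.≤ + b
  -a≤b = ℤ.≤-trans (ℤ.neg-mono-≤ (ℤ.+≤+ ℕ.z≤n)) (ℤ.+≤+ ℕ.z≤n)

  -- Adding a to the slope turns -a < slope ≤ b into 0 < drop ≤ a + b.
  cellSum-h⁺ : ∀ (μ : Vec ℕ a) → + h⁺ μ b ≡ cellSum (λ x y → P⁺ a b (drop x y)) μ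
  cellSum-h⁺ μ = begin
    + h⁺ μ b
      ≡⟨ length-filter (λ c → - (+ a) ℤ.<? slope μ b c ×-dec slope μ b c ℤ.≤? + b) (cells μ) ⟩
    sum (cells μ) (λ c → 𝟙 (- (+ a) ℤ.<? slope μ b c ×-dec slope μ b c ℤ.≤? + b))
      ≡⟨ sum-cong (cells μ) (λ c → counted (slope μ b c)) ⟩
    sum (cells μ) (λ c → P⁺ a b (drop (+ arm μ c) (+ leg μ c)))
      ≡⟨ sum-cells-arm-leg (λ x y → P⁺ a b (drop x y)) μ ⟩
    cellSum (λ x y → P⁺ a b (drop x y)) μ ∎
    where
    shift₁ : ∀ s a → s ℤ.+ a - s ≡ 0ℤ - - a
    shift₁ = solve-∀
    shift₂ : ∀ s a b → s ℤ.+ a - s ≡ a ℤ.+ b - b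
    shift₂ = solve-∀

    counted : ∀ s → 𝟙 (- (+ a) ℤ.<? s ×-dec s ℤ.≤? + b) ≡ P⁺ a b (s ℤ.+ + a)
    counted s = trans (𝟙-interval-<≤ s -a≤b) (cong₂ _-_
      (𝟙-<-shift (- (+ a)) s 0ℤ (s ℤ.+ + a) (sym (shift₁ s (+ a))))
      (𝟙-<-shift (+ b) s (n a b) (s ℤ.+ + a) (sym (shift₂ s (+ a) (+ b)))))

  cellSum-h⁻ : ∀ (μ : Vec ℕ a) → + h⁻ μ b ≡ cellSum (λ x y → P⁻ a b (drop x y)) μ
  cellSum-h⁻ μ = begin
    + h⁻ μ b
      ≡⟨ length-filter (λ c → - (+ a) ℤ.≤? slope μ b c ×-dec slope μ b c ℤ.<? + b) (cells μ) ⟩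
    sum (cells μ) (λ c → 𝟙 (- (+ a) ℤ.≤? slope μ b c ×-dec slope μ b c ℤ.<? + b))
      ≡⟨ sum-cong (cells μ) (λ c → counted (slope μ b c)) ⟩
    sum (cells μ) (λ c → P⁻ a b (drop (+ arm μ c) (+ leg μ c)))
      ≡⟨ sum-cells-arm-leg (λ x y → P⁻ a b (drop x y)) μ ⟩
    cellSum (λ x y → P⁻ a b (drop x y)) μ ∎
    where
    shift₁ : ∀ s a → s ℤ.+ a - s ≡ 0ℤ - - a
    shift₁ = solve-∀
    shift₂ : ∀ s a b → s ℤ.+ a - s ≡ a ℤ.+ b - b
    shift₂ = solve-∀

    counted : ∀ s → 𝟙 (- (+ a) ℤ.≤? s ×-dec s ℤ.<? + b) ≡ P⁻ a b (s ℤ.+ + a)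
    counted s = trans (𝟙-interval-≤< s -a≤b) (cong₂ _-_
      (𝟙-<-shift s (+ b) (s ℤ.+ + a) (n a b) (shift₂ s (+ a) (+ b)))
      (𝟙-<-shift s (- (+ a)) (s ℤ.+ + a) 0ℤ (shift₁ s (+ a))))

  -- Widening the box by one column moves its right edge away from every column, which adds a to the
  -- drops; a new full row raises every column by one cell, which subtracts b.
  easts-frontier : ∀ (P : ℤ → ℤ) {B} {μ : Vec ℕ k} → Box B μ →
    easts a b P (frontier B μ) ≡ sum (upTo B) λ x → P (drop (+ (B ℕ.∸ suc x)) (column μ x))
  easts-frontier P start = refl
  easts-frontier P (east {b = B} {μ} β) = begin
    easts a b P (frontier (suc B) μ)
      ≡⟨ cong (easts a b P) (frontier-east (box-≤ β)) ⟩
    easts a b P (frontier B μ ∷ʳ east)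
      ≡⟨ easts-∷ʳ-east a b P (frontier B μ) ⟩
    easts a b (λ d → P (d ℤ.+ + a)) (frontier B μ) ℤ.+ P (+ a)
      ≡⟨ cong (ℤ._+ P (+ a)) (easts-frontier (λ d → P (d ℤ.+ + a)) β) ⟩
    sum (upTo B) (λ x → P (drop (+ (B ℕ.∸ suc x)) (column μ x) ℤ.+ + a)) ℤ.+ P (+ a)
      ≡⟨ cong₂ ℤ._+_ (sum-cong-∈ (upTo B) λ x∈ → cong P (step (∈-upTo⁻ x∈))) (cong P last) ⟩
    sum (upTo B) (λ x → P (drop (+ (B ℕ.∸ x)) (column μ x))) ℤ.+ P (drop (+ (B ℕ.∸ B)) (column μ B))
      ≡⟨ sum-upTo-last B (λ x → P (drop (+ (B ℕ.∸ x)) (column μ x))) ⟨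
    sum (upTo (suc B)) (λ x → P (drop (+ (B ℕ.∸ x)) (column μ x))) ∎
    where
    lemma : ∀ a b x y → a ℤ.* x - b ℤ.* y ℤ.+ a ℤ.+ a ≡ a ℤ.* (1ℤ ℤ.+ x) - b ℤ.* y ℤ.+ a
    lemma = solve-∀

    step : ∀ {x} → x ℕ.< B → drop (+ (B ℕ.∸ suc x)) (column μ x) ℤ.+ + a ≡ drop (+ (B ℕ.∸ x)) (column μ x)
    step {x} x<B = trans (lemma (+ a) (+ b) (+ (B ℕ.∸ suc x)) (column μ x))
      (cong (λ i → drop (+ i) (column μ x)) (sym (ℕ.+-∸-assoc 1 x<B)))

    lemma₀ : ∀ a b → a ≡ a ℤ.* 0ℤ - b ℤ.* 0ℤ ℤ.+ a
    lemma₀ = solve-∀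

    -- The new column is empty and touches the right edge, so only the constant term of `drop`
    -- remains.
    last : + a ≡ drop (+ (B ℕ.∸ B)) (column μ B)
    last = trans (lemma₀ (+ a) (+ b)) (sym (cong₂ drop (cong +_ (ℕ.n∸n≡0 B)) (column-outside (box-≤ β))))
  easts-frontier P (north {b = B} {μ} β) = begin
    easts a b P (frontier B (B ∷ μ))
      ≡⟨ cong (easts a b P) (frontier-north B μ) ⟩
    easts a b P (frontier B μ ∷ʳ north)
      ≡⟨ easts-∷ʳ-north a b P (frontier B μ) ⟩
    easts a b (λ d → P (d - + b)) (frontier B μ)
      ≡⟨ easts-frontier (λ d → P (d - + b)) β ⟩
    sum (upTo B) (λ x → P (drop (+ (B ℕ.∸ suc x)) (column μ x) - + b))
      ≡⟨ sum-cong-∈ (upTo B) (λ {x} x∈ → cong P (trans (lemma (+ a) (+ b) (+ (B ℕ.∸ suc x)) (column μ x))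
           (cong (λ z → drop (+ (B ℕ.∸ suc x)) (z ℤ.+ column μ x)) (sym (𝟙-yes (x ℕ.<? B) (∈-upTo⁻ x∈)))))) ⟩
    sum (upTo B) (λ x → P (drop (+ (B ℕ.∸ suc x)) (column (B ∷ μ) x))) ∎
    where
    lemma : ∀ a b x y → a ℤ.* x - b ℤ.* y ℤ.+ a - b ≡ a ℤ.* x - b ℤ.* (1ℤ ℤ.+ y) ℤ.+ a
    lemma = solve-∀

  pairs-frontier : ∀ (P : ℤ → ℤ) {B} {μ : Vec ℕ k} → Box B μ →
    pairs a b P (frontier B μ) ≡ cellSum (λ x y → P (drop x y)) μ
  pairs-frontier P start = refl
  pairs-frontier P (east {b = B} {μ} β) = begin
    pairs a b P (frontier (suc B) μ)   ≡⟨ cong (pairs a b P) (frontier-east (box-≤ β)) ⟩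
    pairs a b P (frontier B μ ∷ʳ east) ≡⟨ pairs-∷ʳ-east a b P (frontier B μ) ⟩
    pairs a b P (frontier B μ)         ≡⟨ pairs-frontier P β ⟩
    cellSum (λ x y → P (drop x y)) μ   ∎
  pairs-frontier P (north {b = B} {μ} β) = begin
    pairs a b P (frontier B (B ∷ μ))    ≡⟨ cong (pairs a b P) (frontier-north B μ) ⟩
    pairs a b P (frontier B μ ∷ʳ north) ≡⟨ pairs-∷ʳ-north a b P (frontier B μ) ⟩
    pairs a b P (frontier B μ) ℤ.+ easts a b P (frontier B μ)
      ≡⟨ ℤ.+-comm (pairs a b P (frontier B μ)) _ ⟩
    easts a b P (frontier B μ) ℤ.+ pairs a b P (frontier B μ)
      ≡⟨ cong₂ ℤ._+_ (easts-frontier P β) (pairs-frontier P β) ⟩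
    cellSum (λ x y → P (drop x y)) (B ∷ μ) ∎

  ml≡minLevel : ∀ (μ : Vec ℕ a) → ml b μ ≡ minLevel a b 0ℤ (frontier b μ)
  ml≡minLevel μ = trans (go 0 0 (frontier b μ))
    (cong (λ l → minLevel a b l (frontier b μ)) (lemma (+ a) (+ b)))
    where
    lemma : ∀ a b → b ℤ.* 0ℤ - a ℤ.* 0ℤ ≡ 0ℤ
    lemma = solve-∀

    go : ∀ x y w → foldr₁ ℤ._⊓_ (List⁺.map (level a b) (pointsFrom (x , y) w)) ≡ minLevel a b (level a b (x , y)) w
    go x y []          = refl
    go x y (north ∷ w) = cong (level a b (x , y) ℤ.⊓_) (trans (go x (suc y) w)
      (cong (λ l → minLevel a b l w) (up (+ a) (+ b) (+ x) (+ y))))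
      where
      up : ∀ a b x y → b ℤ.* (1ℤ ℤ.+ y) - a ℤ.* x ≡ b ℤ.* y - a ℤ.* x ℤ.+ b
      up = solve-∀
    go x y (east ∷ w) = cong (level a b (x , y) ℤ.⊓_) (trans (go (suc x) y w)
      (cong (λ l → minLevel a b l w) (right (+ a) (+ b) (+ x) (+ y))))
      where
      right : ∀ a b x y → b ℤ.* y - a ℤ.* (1ℤ ℤ.+ x) ≡ b ℤ.* y - a ℤ.* x ℤ.+ - a
      right = solve-∀

  weight-frontier : ∀ {B} {μ : Vec ℕ k} → Box B μ → weight a b (frontier B μ) ≡ + b ℤ.* + k - + a ℤ.* + B
  weight-frontier start = lemma (+ a) (+ b)
    where
    lemma : ∀ a b → 0ℤ ≡ b ℤ.* 0ℤ - a ℤ.* 0ℤ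
    lemma = solve-∀
  weight-frontier {k} (east {b = B} {μ} β) = begin
    weight a b (frontier (suc B) μ)        ≡⟨ cong (weight a b) (frontier-east (box-≤ β)) ⟩
    weight a b (frontier B μ ∷ʳ east)      ≡⟨ weight-∷ʳ a b (frontier B μ) east ⟩
    weight a b (frontier B μ) ℤ.+ - (+ a)  ≡⟨ cong (ℤ._+ - (+ a)) (weight-frontier β) ⟩
    + b ℤ.* + k - + a ℤ.* + B ℤ.+ - (+ a)  ≡⟨ lemma (+ a) (+ b) (+ k) (+ B) ⟩
    + b ℤ.* + k - + a ℤ.* + suc B          ∎
    where
    lemma : ∀ a b k B → b ℤ.* k - a ℤ.* B ℤ.+ - a ≡ b ℤ.* k - a ℤ.* (1ℤ ℤ.+ B)
    lemma = solve-∀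
  weight-frontier {suc k} (north {b = B} {μ} β) = begin
    weight a b (frontier B (B ∷ μ))        ≡⟨ cong (weight a b) (frontier-north B μ) ⟩
    weight a b (frontier B μ ∷ʳ north)     ≡⟨ weight-∷ʳ a b (frontier B μ) north ⟩
    weight a b (frontier B μ) ℤ.+ + b      ≡⟨ cong (ℤ._+ + b) (weight-frontier β) ⟩
    + b ℤ.* + k - + a ℤ.* + B ℤ.+ + b      ≡⟨ lemma (+ a) (+ b) (+ k) (+ B) ⟩
    + b ℤ.* + suc k - + a ℤ.* + B          ∎
    where
    lemma : ∀ a b k B → b ℤ.* k - a ℤ.* B ℤ.+ b ≡ b ℤ.* (1ℤ ℤ.+ k) - a ℤ.* B
    lemma = solve-∀

  -- `InTriangle` with the number of rows k detached from the slope parameter a, since the induction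
  -- removes rows while the diagonal keeps its direction.
  BelowDiagonal : Vec ℕ k → Set
  BelowDiagonal {k} μ = ∀ i → a ℕ.* lookup μ i ℕ.≤ b ℕ.* (k ℕ.∸ suc (toℕ i))

  0≤level : ∀ x y → a ℕ.* x ℕ.≤ b ℕ.* y → 0ℤ ℤ.≤ + b ℤ.* + y - + a ℤ.* + x
  0≤level x y le = ℤ.i≤j⇒0≤j-i (subst₂ ℤ._≤_ (ℤ.pos-* a x) (ℤ.pos-* b y) (ℤ.+≤+ le))

  0≤level⁻ : ∀ x y → 0ℤ ℤ.≤ + b ℤ.* + y - + a ℤ.* + x → a ℕ.* x ℕ.≤ b ℕ.* y
  0≤level⁻ x y le = ℤ.drop‿+≤+ (subst₂ ℤ._≤_ (sym (ℤ.pos-* a x)) (sym (ℤ.pos-* b y)) (ℤ.0≤i-j⇒j≤i le))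

  -- Along an east step the level only drops, so it is enough to look at the levels where a north step starts, and at the end.
  minLevel-frontier : ∀ {B} {μ : Vec ℕ k} → Box B μ → 0ℤ ℤ.≤ + b ℤ.* + k - + a ℤ.* + B →
    (0ℤ ℤ.≤ minLevel a b 0ℤ (frontier B μ) → BelowDiagonal μ) ×
    (BelowDiagonal μ → 0ℤ ℤ.≤ minLevel a b 0ℤ (frontier B μ))
  minLevel-frontier start _ = (λ _ ()) , λ _ → ℤ.≤-refl
  minLevel-frontier {k} (east {b = B} {μ} β) 0≤end =
    (λ le → proj₁ ih (ℤ.≤-trans le (ℤ.≤-trans (ℤ.≤-reflexive split) (ℤ.i⊓j≤i (minLevel a b 0ℤ (frontier B μ)) _)))) ,
    (λ diag → subst (0ℤ ℤ.≤_) (sym split) (ℤ.⊓-glb (proj₂ ih diag) 0≤end′))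
    where
    split : minLevel a b 0ℤ (frontier (suc B) μ) ≡
            minLevel a b 0ℤ (frontier B μ) ℤ.⊓ (0ℤ ℤ.+ weight a b (frontier B μ ∷ʳ east))
    split = trans (cong (minLevel a b 0ℤ) (frontier-east (box-≤ β))) (minLevel-∷ʳ a b 0ℤ (frontier B μ) east)

    0≤end′ : 0ℤ ℤ.≤ 0ℤ ℤ.+ weight a b (frontier B μ ∷ʳ east)
    0≤end′ = subst (0ℤ ℤ.≤_) (sym (trans (ℤ.+-identityˡ _)
      (trans (cong (weight a b) (sym (frontier-east (box-≤ β)))) (weight-frontier (east β))))) 0≤end

    ih = minLevel-frontier β (0≤level B k (ℕ.≤-trans (ℕ.*-monoʳ-≤ a (ℕ.n≤1+n B)) (0≤level⁻ (suc B) k 0≤end)))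
  minLevel-frontier {suc k} (north {b = B} {μ} β) 0≤end =
    (λ le → let 0≤min = ℤ.≤-trans le (ℤ.≤-trans (ℤ.≤-reflexive split) (ℤ.i⊓j≤i (minLevel a b 0ℤ (frontier B μ)) _))
                0≤bk-aB = subst (0ℤ ℤ.≤_) (trans (ℤ.+-identityˡ _) (weight-frontier β))
                            (ℤ.≤-trans 0≤min (minLevel≤end a b 0ℤ (frontier B μ)))
            in λ { zero → 0≤level⁻ B k 0≤bk-aB ; (suc i) → proj₁ (minLevel-frontier β 0≤bk-aB) 0≤min i }) ,
    (λ diag → subst (0ℤ ℤ.≤_) (sym split)
      (ℤ.⊓-glb (proj₂ (minLevel-frontier β (0≤level B k (diag zero))) (diag ∘ suc)) 0≤end′))
    where
    split : minLevel a b 0ℤ (frontier B (B ∷ μ)) ≡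
            minLevel a b 0ℤ (frontier B μ) ℤ.⊓ (0ℤ ℤ.+ weight a b (frontier B μ ∷ʳ north))
    split = trans (cong (minLevel a b 0ℤ) (frontier-north B μ)) (minLevel-∷ʳ a b 0ℤ (frontier B μ) north)

    0≤end′ : 0ℤ ℤ.≤ 0ℤ ℤ.+ weight a b (frontier B μ ∷ʳ north)
    0≤end′ = subst (0ℤ ℤ.≤_) (sym (trans (ℤ.+-identityˡ _)
      (trans (cong (weight a b) (sym (frontier-north B μ))) (weight-frontier (north β))))) 0≤end

  negatives : ℤ → Word → ℤ
  negatives = stepSum a b λ _ x → 𝟙 (x ℤ.<? 0ℤ)

  0≤negatives : ∀ l w → 0ℤ ℤ.≤ negatives l w
  0≤negatives l []      = ℤ.≤-refl
  0≤negatives l (s ∷ w) = ℤ.+-mono-≤ (0≤𝟙 (l ℤ.<? 0ℤ)) (0≤negatives (l ℤ.+ wt a b s) w)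
    where
    0≤𝟙 : ∀ {P : Set} (d : Dec P) → 0ℤ ℤ.≤ 𝟙 d
    0≤𝟙 (yes _) = ℤ.+≤+ ℕ.z≤n
    0≤𝟙 (no _)  = ℤ.≤-refl

  -- The assumption on the end level supplies the one point that `minLevel` sees and `negatives`
  -- does not.
  negatives≡0⇒0≤minLevel : ∀ l w → 0ℤ ℤ.≤ l ℤ.+ weight a b w → negatives l w ≡ 0ℤ → 0ℤ ℤ.≤ minLevel a b l w
  negatives≡0⇒0≤minLevel l []      0≤end _  = subst (0ℤ ℤ.≤_) (ℤ.+-identityʳ l) 0≤end
  negatives≡0⇒0≤minLevel l (s ∷ w) 0≤end eq = go (l ℤ.<? 0ℤ)
    where
    go : Dec (l ℤ.< 0ℤ) → 0ℤ ℤ.≤ minLevel a b l (s ∷ w)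
    go (yes l<0) = contradiction
      (subst (1ℤ ℤ.≤_) (trans (cong (ℤ._+ negatives (l ℤ.+ wt a b s) w) (sym (𝟙-yes (l ℤ.<? 0ℤ) l<0))) eq)
        (ℤ.+-monoʳ-≤ 1ℤ (0≤negatives (l ℤ.+ wt a b s) w)))
      λ { (ℤ.+≤+ ()) }
    go (no l≮0) = ℤ.⊓-glb (ℤ.≮⇒≥ l≮0) (negatives≡0⇒0≤minLevel (l ℤ.+ wt a b s) w
      (subst (0ℤ ℤ.≤_) (sym (ℤ.+-assoc l (wt a b s) (weight a b w))) 0≤end)
      (trans (sym (ℤ.+-identityˡ _))
        (trans (cong (ℤ._+ negatives (l ℤ.+ wt a b s) w) (sym (𝟙-no (l ℤ.<? 0ℤ) l≮0))) eq)))

  0≤minLevel⇒negatives≡0 : ∀ l w → 0ℤ ℤ.≤ minLevel a b l w → negatives l w ≡ 0ℤ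
  0≤minLevel⇒negatives≡0 l []      _  = refl
  0≤minLevel⇒negatives≡0 l (s ∷ w) le = cong₂ ℤ._+_
    (𝟙-no (l ℤ.<? 0ℤ) (ℤ.≤⇒≯ (ℤ.≤-trans le (ℤ.i⊓j≤i l _))))
    (0≤minLevel⇒negatives≡0 (l ℤ.+ wt a b s) w (ℤ.≤-trans le (ℤ.i⊓j≤j l _)))

  module _ (μ : Vec ℕ a) (μ∈ : InBox b μ) where

    private
      β : Box b μ
      β = inBox⇒box μ μ∈

      w : Word
      w = frontier b μ

    weight≡0 : weight a b w ≡ 0ℤ
    weight≡0 = trans (weight-frontier β) (lemma (+ a) (+ b))
      where
      lemma : ∀ a b → b ℤ.* a - a ℤ.* b ≡ 0ℤ
      lemma = solve-∀

    inTriangle⇒0≤minLevel : InTriangle b μ → 0ℤ ℤ.≤ minLevel a b 0ℤ w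
    inTriangle⇒0≤minLevel = proj₂ (minLevel-frontier β (ℤ.≤-reflexive (trans (sym weight≡0) (weight-frontier β))))

    inTriangle⇒below≡0 : InTriangle b μ → below a b w ≡ 0ℤ
    inTriangle⇒below≡0 = 0≤minLevel⇒negatives≡0 0ℤ w ∘ inTriangle⇒0≤minLevel

    below≡0⇒inTriangle : below a b w ≡ 0ℤ → InTriangle b μ
    below≡0⇒inTriangle = proj₁ (minLevel-frontier β (ℤ.≤-reflexive (trans (sym weight≡0) (weight-frontier β))))
      ∘ negatives≡0⇒0≤minLevel 0ℤ w (ℤ.≤-reflexive (sym (trans (ℤ.+-identityˡ _) weight≡0)))

    size-frontier : + size μ ≡ pairs a b (λ _ → 1ℤ) w
    size-frontier = trans (sym (cellSum-1 μ)) (sym (pairs-frontier (λ _ → 1ℤ) β))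

    h⁺-frontier : + h⁺ μ b ≡ pairs a b (P⁺ a b) w
    h⁺-frontier = trans (cellSum-h⁺ μ) (sym (pairs-frontier (P⁺ a b) β))

    h⁻-frontier : + h⁻ μ b ≡ pairs a b (P⁻ a b) w
    h⁻-frontier = trans (cellSum-h⁻ μ) (sym (pairs-frontier (P⁻ a b) β))

    stat⁺-frontier : + size μ ℤ.+ ml b μ ℤ.+ + h⁺ μ b ≡ stat a b (P⁺ a b) w
    stat⁺-frontier = cong₂ ℤ._+_ (cong₂ ℤ._+_ size-frontier (ml≡minLevel μ)) h⁺-frontier

    stat⁻-frontier : + size μ ℤ.+ ml b μ ℤ.+ + h⁻ μ b ≡ stat a b (P⁻ a b) w
    stat⁻-frontier = cong₂ ℤ._+_ (cong₂ ℤ._+_ size-frontier (ml≡minLevel μ)) h⁻-frontier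

    -- Inside the triangle the minimum level is attained at the start, so both corrections in
    -- `base`, the minimum level and `below`, vanish.
    base-frontier : InTriangle b μ → + (size μ + h⁺ μ b) ≡ base a b (P⁺ a b) w
    base-frontier tri = begin
      + size μ ℤ.+ + h⁺ μ b
        ≡⟨ cong₂ ℤ._+_ size-frontier h⁺-frontier ⟩
      pairs a b (λ _ → 1ℤ) w ℤ.+ pairs a b (P⁺ a b) w
        ≡⟨ lemma (pairs a b (λ _ → 1ℤ) w) (pairs a b (P⁺ a b) w) ⟩
      pairs a b (λ _ → 1ℤ) w ℤ.+ 0ℤ ℤ.+ pairs a b (P⁺ a b) w - 0ℤ
        ≡⟨ cong₂ (λ m r → pairs a b (λ _ → 1ℤ) w ℤ.+ m ℤ.+ pairs a b (P⁺ a b) w - r)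
             (ℤ.≤-antisym (minLevel≤start a b 0ℤ w) (inTriangle⇒0≤minLevel tri)) (inTriangle⇒below≡0 tri) ⟨
      base a b (P⁺ a b) w ∎
      where
      lemma : ∀ x y → x ℤ.+ y ≡ x ℤ.+ 0ℤ ℤ.+ y - 0ℤ
      lemma = solve-∀

-- Generating functions

δ : ℤ → ℤ → ℤ
δ m e = termCoeff 1ℤ e m

δ-shift : ∀ m e i → δ (m - i) e ≡ δ m (e ℤ.+ i)
δ-shift m e i = 𝟙-cong (e ℤ.≟ m - i) (e ℤ.+ i ℤ.≟ m)
  (λ eq → trans (cong (ℤ._+ i) eq) (lemma₁ m i))
  (λ eq → trans (lemma₂ e i) (cong (_- i) eq))
  where
  lemma₁ : ∀ m i → m - i ℤ.+ i ≡ m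
  lemma₁ = solve-∀
  lemma₂ : ∀ e i → e ≡ e ℤ.+ i - i
  lemma₂ = solve-∀

coeff-∑ : ∀ {A : Set} (xs : List A) (e : A → ℤ) m → coeff (∑ xs λ x → q^ e x) m ≡ sum xs (δ m ∘ e)
coeff-∑ []       e m = refl
coeff-∑ (x ∷ xs) e m = cong (λ z → δ m (e x) ℤ.+ z) (coeff-∑ xs e m)

convolve-∑ : ∀ {A : Set} (xs : List A) (e : A → ℤ) g m →
  convolve (∑ xs λ x → q^ e x) g m ≡ sum xs λ x → g (m - e x)
convolve-∑ []       e g m = refl
convolve-∑ (x ∷ xs) e g m = cong₂ ℤ._+_ (ℤ.*-identityˡ (g (m - e x))) (convolve-∑ xs e g m)

convolve-++ : ∀ p r g m → convolve (p ++ r) g m ≡ convolve p g m ℤ.+ convolve r g m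
convolve-++ []            r g m = sym (ℤ.+-identityˡ _)
convolve-++ ((c , e) ∷ p) r g m = trans (cong (λ z → c ℤ.* g (m - e) ℤ.+ z) (convolve-++ p r g m))
  (sym (ℤ.+-assoc (c ℤ.* g (m - e)) _ _))

-- Polynomials act on coefficient functions by `convolve`. That this action is multiplicative is the
-- source of associativity of `⊗`.
convolve-⊗ : ∀ p r g m → convolve (p ⊗ r) g m ≡ convolve p (convolve r g) m
convolve-⊗ []            r g m = refl
convolve-⊗ ((c , e) ∷ p) r g m = trans (convolve-++ (map _ r) (p ⊗ r) g m)
  (cong₂ ℤ._+_ (scale r) (convolve-⊗ p r g m))
  where
  assoc : ∀ m e f → m - (e ℤ.+ f) ≡ m - e - f
  assoc = solve-∀

  scale : ∀ r → convolve (map (λ (d , f) → c ℤ.* d , e ℤ.+ f) r) g m ≡ c ℤ.* convolve r g (m - e)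
  scale []            = sym (ℤ.*-zeroʳ c)
  scale ((d , f) ∷ r) = trans
    (cong₂ ℤ._+_ (trans (ℤ.*-assoc c d (g (m - (e ℤ.+ f)))) (cong (λ i → c ℤ.* (d ℤ.* g i)) (assoc m e f))) (scale r))
    (sym (ℤ.*-distribˡ-+ c (d ℤ.* g (m - e - f)) (convolve r g (m - e))))

⊗-comm : ∀ p r → p ⊗ r ≈ r ⊗ p
⊗-comm p r m = trans (coeff-⊗-comm p r m) (sym (coeff-⊗ˡ r p m))

⊗-assoc : ∀ p r s → (p ⊗ r) ⊗ s ≈ p ⊗ (r ⊗ s)
⊗-assoc p r s m = begin
  coeff ((p ⊗ r) ⊗ s) m            ≡⟨ coeff-⊗ˡ (p ⊗ r) s m ⟩
  convolve (p ⊗ r) (coeff s) m     ≡⟨ convolve-⊗ p r (coeff s) m ⟩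
  convolve p (convolve r (coeff s)) m ≡⟨ convolve-cong p (λ i → sym (coeff-⊗ˡ r s i)) m ⟩
  convolve p (coeff (r ⊗ s)) m     ≡⟨ coeff-⊗ˡ p (r ⊗ s) m ⟨
  coeff (p ⊗ (r ⊗ s)) m ∎

⊗-identityˡ : ∀ p → q^ 0ℤ ⊗ p ≈ p
⊗-identityˡ p m = begin
  coeff (q^ 0ℤ ⊗ p) m              ≡⟨ coeff-⊗ˡ (q^ 0ℤ) p m ⟩
  1ℤ ℤ.* coeff p (m - 0ℤ) ℤ.+ 0ℤ   ≡⟨ ℤ.+-identityʳ _ ⟩
  1ℤ ℤ.* coeff p (m - 0ℤ)          ≡⟨ ℤ.*-identityˡ _ ⟩
  coeff p (m - 0ℤ)                 ≡⟨ cong (coeff p) (ℤ.+-identityʳ m) ⟩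
  coeff p m ∎

-- Coefficients of the partition sums

module _ (a b : ℕ) (coprime : Coprime a b) where

  private
    ∈R⇒inBox : ∀ {μ} → μ ∈ R a b → InBox b μ
    ∈R⇒inBox μ∈ = proj₂ (∈-filter⁻ (inBox? b) {xs = vectors (upTo (suc b)) a} μ∈)

    base⁺ : Word → ℤ
    base⁺ = base a b (P⁺ a b)

  coeff-R-sum⁺ : ∀ m → coeff (R-sum⁺ a b) m ≡ sum (balanced a b) (δ m ∘ stat a b (P⁺ a b))
  coeff-R-sum⁺ m = begin
    coeff (R-sum⁺ a b) m
      ≡⟨ coeff-∑ (R a b) (λ μ → + size μ ℤ.+ ml b μ ℤ.+ + h⁺ μ b) m ⟩
    sum (R a b) (λ μ → δ m (+ size μ ℤ.+ ml b μ ℤ.+ + h⁺ μ b))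
      ≡⟨ sum-cong-∈ (R a b) (λ {μ} μ∈ → cong (δ m) (stat⁺-frontier a b μ (∈R⇒inBox μ∈))) ⟩
    sum (R a b) (δ m ∘ stat a b (P⁺ a b) ∘ frontier b)
      ≡⟨ sum-R a b (δ m ∘ stat a b (P⁺ a b)) ⟩
    sum (balanced a b) (δ m ∘ stat a b (P⁺ a b)) ∎

  R-sum⁺≈R-sum⁻ : R-sum⁺ a b ≈ R-sum⁻ a b
  R-sum⁺≈R-sum⁻ m = begin
    coeff (R-sum⁺ a b) m
      ≡⟨ coeff-R-sum⁺ m ⟩
    sum (balanced a b) (δ m ∘ stat a b (P⁺ a b))
      ≡⟨ sum-cong-∈ (balanced a b) (λ {w} w∈ → cong (δ m) (stat⁺≡stat⁻ a b coprime w (balanced-counts w∈))) ⟩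
    sum (balanced a b) (δ m ∘ stat a b (P⁻ a b))
      ≡⟨ sum-R a b (δ m ∘ stat a b (P⁻ a b)) ⟨
    sum (R a b) (δ m ∘ stat a b (P⁻ a b) ∘ frontier b)
      ≡⟨ sum-cong-∈ (R a b) (λ {μ} μ∈ → cong (δ m) (stat⁻-frontier a b μ (∈R⇒inBox μ∈))) ⟨
    sum (R a b) (λ μ → δ m (+ size μ ℤ.+ ml b μ ℤ.+ + h⁻ μ b))
      ≡⟨ coeff-∑ (R a b) (λ μ → + size μ ℤ.+ ml b μ ℤ.+ + h⁻ μ b) m ⟨
    coeff (R-sum⁻ a b) m ∎

  coeff-D-sum : ∀ m → coeff (D-sum a b) m ≡
    sum (balanced a b) λ w → 𝟙 (below a b w ℤ.≟ 0ℤ) ℤ.* δ m (base⁺ w)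
  coeff-D-sum m = begin
    coeff (D-sum a b) m
      ≡⟨ coeff-∑ (D a b) (λ μ → + (size μ + h⁺ μ b)) m ⟩
    sum (D a b) (λ μ → δ m (+ (size μ + h⁺ μ b)))
      ≡⟨ sum-filter (inTriangle? b) (R a b) (λ μ → δ m (+ (size μ + h⁺ μ b))) ⟩
    sum (R a b) (λ μ → 𝟙 (inTriangle? b μ) ℤ.* δ m (+ (size μ + h⁺ μ b)))
      ≡⟨ sum-cong-∈ (R a b) (λ {μ} μ∈ → term μ (∈R⇒inBox μ∈)) ⟩
    sum (R a b) (λ μ → 𝟙 (below a b (frontier b μ) ℤ.≟ 0ℤ) ℤ.* δ m (base⁺ (frontier b μ)))
      ≡⟨ sum-R a b (λ w → 𝟙 (below a b w ℤ.≟ 0ℤ) ℤ.* δ m (base⁺ w)) ⟩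
    sum (balanced a b) (λ w → 𝟙 (below a b w ℤ.≟ 0ℤ) ℤ.* δ m (base⁺ w)) ∎
    where
    term : ∀ μ → InBox b μ → 𝟙 (inTriangle? b μ) ℤ.* δ m (+ (size μ + h⁺ μ b)) ≡
      𝟙 (below a b (frontier b μ) ℤ.≟ 0ℤ) ℤ.* δ m (base⁺ (frontier b μ))
    term μ μ∈ = trans
      (𝟙-*-cong (inTriangle? b μ) (cong (δ m) ∘ base-frontier a b μ μ∈))
      (cong (ℤ._* δ m (base⁺ (frontier b μ)))
        (𝟙-cong (inTriangle? b μ) (below a b (frontier b μ) ℤ.≟ 0ℤ)
          (inTriangle⇒below≡0 a b μ μ∈) (below≡0⇒inTriangle a b μ μ∈)))

  n*coeff-R-sum : ∀ m → n a b ℤ.* coeff (R-sum⁺ a b) m ≡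
    sum (balanced a b) λ w → sum (upTo (a + b)) λ i → δ m (base⁺ w ℤ.+ + i)
  n*coeff-R-sum m = trans
    (cong (n a b ℤ.*_) (trans (coeff-R-sum⁺ m)
      (sum-cong (balanced a b) λ w → cong (δ m) (lemma (stat a b (P⁺ a b) w) (below a b w)))))
    (sum-below-base a b coprime λ r g → δ m (g ℤ.+ r))
    where
    lemma : ∀ s r → s ≡ s - r ℤ.+ r
    lemma = solve-∀

  n*coeff-D-sum : ∀ m → .{{_ : NonZero a}} →
    n a b ℤ.* coeff (D-sum a b) m ≡ sum (balanced a b) (δ m ∘ base⁺)
  n*coeff-D-sum m = begin
    n a b ℤ.* coeff (D-sum a b) m
      ≡⟨ cong (n a b ℤ.*_) (coeff-D-sum m) ⟩
    n a b ℤ.* sum (balanced a b) (λ w → 𝟙 (below a b w ℤ.≟ 0ℤ) ℤ.* δ m (base⁺ w))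
      ≡⟨ sum-below-base a b coprime (λ r g → 𝟙 (r ℤ.≟ 0ℤ) ℤ.* δ m g) ⟩
    sum (balanced a b) (λ w → sum (upTo (a + b)) λ i → 𝟙 (+ i ℤ.≟ 0ℤ) ℤ.* δ m (base⁺ w))
      ≡⟨ sum-cong (balanced a b) (λ w → trans
           (sum-cong (upTo (a + b)) λ i → cong (ℤ._* δ m (base⁺ w))
             (𝟙-cong (+ i ℤ.≟ 0ℤ) (i ℕ.≟ 0) ℤ.+-injective (cong λ i → + i)))
           -- Only the index 0 survives, and it lies in the range because a + b is positive.
           (sum-upTo-𝟙≟ 0 (λ _ → δ m (base⁺ w)) (ℕ.>-nonZero⁻¹ (a + b)))) ⟩
    sum (balanced a b) (δ m ∘ base⁺) ∎

  -- After averaging, each balanced word contributes its base monomial to the triangle side, and the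
  -- same monomial times 1, q, ..., q^(a+b-1) to the full side. Moving each shift onto the
  -- coefficient index gives convolution with `[ a + b ]q`.
  R-sum⁺≈[a+b]⊗D-sum : .{{_ : NonZero a}} → R-sum⁺ a b ≈ [ a + b ]q ⊗ D-sum a b
  R-sum⁺≈[a+b]⊗D-sum m = ℤ.*-cancelˡ-≡ (n a b) (coeff (R-sum⁺ a b) m) (coeff ([ a + b ]q ⊗ D-sum a b) m) (begin
    n a b ℤ.* coeff (R-sum⁺ a b) m
      ≡⟨ n*coeff-R-sum m ⟩
    sum (balanced a b) (λ w → sum (upTo (a + b)) λ i → δ m (base⁺ w ℤ.+ + i))
      ≡⟨ sum-swap (balanced a b) (upTo (a + b)) (λ w i → δ m (base⁺ w ℤ.+ + i)) ⟩
    sum (upTo (a + b)) (λ i → sum (balanced a b) λ w → δ m (base⁺ w ℤ.+ + i))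
      ≡⟨ sum-cong (upTo (a + b)) (λ i → trans
           (n*coeff-D-sum (m - + i))
           (sum-cong (balanced a b) λ w → δ-shift m (base⁺ w) (+ i))) ⟨
    sum (upTo (a + b)) (λ i → n a b ℤ.* coeff (D-sum a b) (m - + i))
      ≡⟨ sum-* (upTo (a + b)) (n a b) (λ i → coeff (D-sum a b) (m - + i)) ⟩
    n a b ℤ.* sum (upTo (a + b)) (λ i → coeff (D-sum a b) (m - + i))
      ≡⟨ cong (n a b ℤ.*_) (convolve-∑ (upTo (a + b)) (λ i → + i) (coeff (D-sum a b)) m) ⟨
    n a b ℤ.* convolve [ a + b ]q (coeff (D-sum a b)) m
      ≡⟨ cong (n a b ℤ.*_) (coeff-⊗ˡ [ a + b ]q (D-sum a b) m) ⟨
    n a b ℤ.* coeff ([ a + b ]q ⊗ D-sum a b) m ∎)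

theorem10 : (a b : ℕ) .{{_ : NonZero a}} .{{_ : NonZero b}} → Coprime a b →
    (1/[ a + b ]q ∙ qBinomial a b ≃ ⟦ D-sum a b ⟧)
    ⇔
    ((qBinomial a b ≃ ⟦ R-sum⁺ a b ⟧) × (⟦ R-sum⁺ a b ⟧ ≃ ⟦ R-sum⁻ a b ⟧))
theorem10 a b coprime = mk⇔
  (λ eq → (λ m → begin
      coeff (N ⊗ q^ 0ℤ) m               ≡⟨ lhs m ⟨
      coeff ((q^ 0ℤ ⊗ N) ⊗ q^ 0ℤ) m     ≡⟨ eq m ⟩
      coeff (D-sum a b ⊗ ([ a + b ]q ⊗ M)) m ≡⟨ rhs m ⟩
      coeff (R-sum⁺ a b ⊗ M) m ∎)
    , ⊗-congˡ (R-sum⁺ a b) (R-sum⁻ a b) (q^ 0ℤ) (R-sum⁺≈R-sum⁻ a b coprime))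
  (λ (eq , _) m → begin
      coeff ((q^ 0ℤ ⊗ N) ⊗ q^ 0ℤ) m     ≡⟨ lhs m ⟩
      coeff (N ⊗ q^ 0ℤ) m               ≡⟨ eq m ⟩
      coeff (R-sum⁺ a b ⊗ M) m          ≡⟨ rhs m ⟨
      coeff (D-sum a b ⊗ ([ a + b ]q ⊗ M)) m ∎)
  where
  N = [ a + b ]!q
  M = [ a ]!q ⊗ [ b ]!q

  lhs : (q^ 0ℤ ⊗ N) ⊗ q^ 0ℤ ≈ N ⊗ q^ 0ℤ
  lhs = ⊗-congˡ (q^ 0ℤ ⊗ N) N (q^ 0ℤ) (⊗-identityˡ N)

  -- The factor `[ a + b ]q` from the denominator on the triangle side is absorbed into the
  -- numerator. The cross-multiplied forms of the two identities then agree coefficient by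
  -- coefficient, so each yields the other without dividing by a polynomial.
  rhs : D-sum a b ⊗ ([ a + b ]q ⊗ M) ≈ R-sum⁺ a b ⊗ M
  rhs m = begin
    coeff (D-sum a b ⊗ ([ a + b ]q ⊗ M)) m
      ≡⟨ ⊗-assoc (D-sum a b) [ a + b ]q M m ⟨
    coeff ((D-sum a b ⊗ [ a + b ]q) ⊗ M) m
      ≡⟨ ⊗-congˡ (D-sum a b ⊗ [ a + b ]q) (R-sum⁺ a b) M
           (λ i → trans (⊗-comm (D-sum a b) [ a + b ]q i) (sym (R-sum⁺≈[a+b]⊗D-sum a b coprime i))) m ⟩
    coeff (R-sum⁺ a b ⊗ M) m ∎
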